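{- Let $k,n,L$ be fixed positive integers with $2k<n$. Then, as $q\to\infty$ over prime powers, there exists an $[n,k,L]_q$-AS family of size at least $$q^{\,n-2k-\frac{(n-k)(k+1)}{L+1}}\,(1+o(1)).$$ Consequently, for fixed $L$, $$p^{AS}(n,k,L)\ge n-2k-\frac{(n-k)(k+1)}{L+1}.$$
   Context: Let $q$ be a prime power and $\mathbb{F}_q$ the field with $q$ elements. A partial $k$-spread in $\mathbb{F}_q^n$ is a collection of $k$-dimensional linear subspaces with pairwise trivial intersection (i.e. equal to $\{0\}$). For positive integers $k,n$ with $2k<n$, a family $\mathcal{F}$ of $k$-dimensional linear subspaces of $\mathbb{F}_q^n$ is $L$-almost sparse, written $[n,k,L]_q$-AS, if (1) $\mathcal{F}$ is a partial $k$-spread of $\mathbb{F}_q^n$, and (2) every $(k+1)$-dimensional linear subspace of $\mathbb{F}_q^n$ intersects non-trivially (in more than $\{0\}$) at most $L$ subspaces from $\mathcal{F}$. $m^{AS}_q(n,k,L)$ denotes the maximal cardinality of an $[n,k,L]_q$-AS family, and $$p^{AS}(n,k,L):=\limsup_{q\to\infty}\log_q\big(m^{AS}_q(n,k,L)\big),$$ with $q$ ranging over prime powers. The term $o(1)$ is a quantity tending to $0$ as $q\to\infty$ with $k,n,L$ fixed. -}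

module Defs where

open import Algebra.Apartness.Bundles using (HeytingField; HeytingCommutativeRing)
open import Algebra.Bundles using (CommutativeRing)
open import Algebra.Definitions.RawMonoid using (sum)
open import Data.Fin.Base using (Fin)
open import Data.Fin.Subset using (Subset; ∣_∣) renaming (_∈_ to _∈ˢ_)
open import Data.Integer.Base as ℤ using (ℤ; +_; -[1+_])
open import Data.Nat.Base using (ℕ; suc; _^_; _≤_; NonZero)
open import Data.Nat.Primality using (Prime; prime⇒nonZero)
open import Data.Nat.Properties using (m^n≢0)
open import Data.Product.Base using (Σ-syntax; ∃-syntax; _×_)
open import Data.Rational.Base as ℚ using (ℚ; 0ℚ; ↥_; ↧ₙ_; _/_)
open import Data.Sum.Base using (_⊎_)
open import Data.Vec.Functional using (Vector)
open import Function.Bundles using (Inverse)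
open import Level using (Level; 0ℓ) renaming (suc to lsuc)
open import Relation.Binary.PropositionalEquality using (_≡_; _≢_; setoid)
open import Relation.Nullary using (¬_)
open import Relation.Unary using (Pred; _∈_; _⊆_; _≐_)
import Data.Vec.Functional.Relation.Binary.Equality.Setoid as VecEq

open import Algebra.Definitions.RawSemiring ℚ.+-*-rawSemiring using () renaming (_^_ to _^ℚ_)

record PrimePower : Set where
  field
    base exponent : ℕ
    isPrime       : Prime base
    exponent≢0    : NonZero exponent

  order : ℕ
  order = base ^ exponent

open PrimePower public

order≢0 : ∀ q → NonZero (order q)
order≢0 q = m^n≢0 (base q) (exponent q) {{prime⇒nonZero (isPrime q)}}

-- A Heyting field with finitely many elements is an ordinary (discrete) field:
-- equality is decidable through the enumeration and an inverse can be searched for.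
record FiniteField (q : ℕ) : Set₁ where
  field
    heytingField : HeytingField 0ℓ 0ℓ 0ℓ

  open HeytingField heytingField using (heytingCommutativeRing)
  open CommutativeRing (HeytingCommutativeRing.commutativeRing heytingCommutativeRing) public
    renaming (setoid to ≈-setoid)

  field
    enumeration : Inverse ≈-setoid (setoid (Fin q))

module LinearAlgebra {q : ℕ} (K : FiniteField q) (n : ℕ) where
  open FiniteField K
  open VecEq ≈-setoid using (_≋_) public

  V : Set
  V = Vector Carrier n

  0ᵛ : V
  0ᵛ _ = 0#

  _+ᵛ_ : V → V → V
  (u +ᵛ v) j = u j + v j

  _·ᵛ_ : Carrier → V → V
  (a ·ᵛ v) j = a * v j

  combination : ∀ {d} → Vector Carrier d → Vector V d → V
  combination c v j = sum +-rawMonoid (λ i → c i * v i j)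

  record Subspace : Set₁ where
    field
      member    : Pred V 0ℓ
      resp-≋    : ∀ {u v} → u ≋ v → u ∈ member → v ∈ member
      0-closed  : 0ᵛ ∈ member
      +-closed  : ∀ {u v} → u ∈ member → v ∈ member → (u +ᵛ v) ∈ member
      ·-closed  : ∀ a {v} → v ∈ member → (a ·ᵛ v) ∈ member

  open Subspace public

  LinearlyIndependent : ∀ {d} → Vector V d → Set
  LinearlyIndependent v = ∀ c → combination c v ≋ 0ᵛ → ∀ i → c i ≈ 0#

  record HasDimension (W : Subspace) (d : ℕ) : Set where
    field
      basis       : Vector V d
      basis∈W     : ∀ i → basis i ∈ member W
      independent : LinearlyIndependent basis
      spanning    : ∀ {v} → v ∈ member W → ∃[ c ] v ≋ combination c basis

  TrivialIntersection : Subspace → Subspace → Set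
  TrivialIntersection U W = ∀ {v} → v ∈ member U → v ∈ member W → v ≋ 0ᵛ

  MeetNontrivially : Subspace → Subspace → Set
  MeetNontrivially U W = ∃[ v ] v ∈ member U × v ∈ member W × ¬ (v ≋ 0ᵛ)

  -- A family of cardinality m is an enumeration, without repetition, by Fin m.
  record IsPartialSpread (k : ℕ) {m : ℕ} (F : Fin m → Subspace) : Set where
    field
      dimension : ∀ i → HasDimension (F i) k
      distinct  : ∀ {i j} → member (F i) ≐ member (F j) → i ≡ j
      disjoint  : ∀ {i j} → i ≢ j → TrivialIntersection (F i) (F j)

  record IsAlmostSparse (k L : ℕ) {m : ℕ} (F : Fin m → Subspace) : Set₁ where
    field
      partialSpread : IsPartialSpread k F
      sparse        : ∀ U → HasDimension U (suc k) →
                      ∀ (S : Subset m) → (∀ {i} → i ∈ˢ S → MeetNontrivially U (F i)) →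
                      ∣ S ∣ ≤ L

-- There is an [n,k,L]_q-AS family of cardinality m.
HasASFamily : ∀ {q} → FiniteField q → (n k L m : ℕ) → Set₁
HasASFamily K n k L m = Σ[ F ∈ (Fin m → Subspace) ] IsAlmostSparse k L F
  where open LinearAlgebra K n

IsMaximum : ∀ {ℓ} → Pred ℕ ℓ → ℕ → Set ℓ
IsMaximum P m = P m × (∀ {m′} → P m′ → m′ ≤ m)

-- An extended real x is represented by its lower cut { t ∈ ℚ | t < x }, so that
-- x ≤ y is inclusion of cuts.
Cut : (ℓ : Level) → Set (lsuc ℓ)
Cut ℓ = Pred ℚ ℓ

infix 4 _≤ᶜ_
_≤ᶜ_ : ∀ {a b} → Cut a → Cut b → Set _
_≤ᶜ_ = _⊆_

⌜_⌝ : ℚ → Cut 0ℓ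
⌜ x ⌝ t = t ℚ.< x

infixr 8 _^ℤ_
_^ℤ_ : PrimePower → ℤ → ℚ
q ^ℤ (+ a)    = (+ (order q ^ a)) / 1
q ^ℤ -[1+ a ] = ((+ 1) / (order q ^ suc a)) {{m^n≢0 (order q) (suc a) {{order≢0 q}}}}

-- t < q^e and q^e < t, where q^(a/b) is the positive real whose b-th power is q^a.
_<[_^_] : ℚ → PrimePower → ℚ → Set
t <[ q ^ e ] = (t ℚ.< 0ℚ) ⊎ ((t ^ℚ (↧ₙ e)) ℚ.< (q ^ℤ (↥ e)))

[_^_]<_ : PrimePower → ℚ → ℚ → Set
[ q ^ e ]< t = (0ℚ ℚ.< t) × ((q ^ℤ (↥ e)) ℚ.< (t ^ℚ (↧ₙ e)))

-- The real x · q^e.  As x may have either sign, the factor q^e is enclosed from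
-- both sides: t < x · q^e iff t < x·s and t < x·s′ for some s < q^e < s′.
_·_^ᶜ_ : ℚ → PrimePower → ℚ → Cut 0ℓ
(x · q ^ᶜ e) t =
  ∃[ s ] ∃[ s′ ] s <[ q ^ e ] × [ q ^ e ]< s′ × t ℚ.< x ℚ.* s × t ℚ.< x ℚ.* s′

-- log_q m, which is -∞ for m = 0.
logᶜ : PrimePower → ℕ → Cut 0ℓ
logᶜ q m r = [ q ^ r ]< ((+ m) / 1)

-- r < limsup a iff some r′ > r lies below a q for arbitrarily large q.
limsup : ∀ {ℓ} → (PrimePower → Cut ℓ) → Cut ℓ
limsup a r = ∃[ r′ ] r ℚ.< r′ × (∀ N → ∃[ q ] N ≤ order q × a q r′)

-- log_q (m^AS_q(n,k,L)).  The maximum does not depend on the choice of K, which is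
-- unique up to isomorphism.
logMaxAS : (n k L : ℕ) → PrimePower → Cut (lsuc 0ℓ)
logMaxAS n k L q r =
  Σ[ K ∈ FiniteField (order q) ] ∃[ m ] IsMaximum (HasASFamily K n k L) m × logᶜ q m r

pAS : (n k L : ℕ) → Cut (lsuc 0ℓ)
pAS n k L = limsup (logMaxAS n k L)

-- δ(q) = o(1) as q → ∞.
Vanishing : (ℕ → ℚ) → Set
Vanishing δ = ∀ ε → 0ℚ ℚ.< ε → ∃[ N ] ∀ q → N ≤ q → ℚ.∣ δ q ∣ ℚ.< ε

-- Write n = k + r and r = k + h.  The subspaces are chosen among the graphs of the
-- k × r matrices A, i.e. the row spaces of (I | A).  For x ≢ 0 exactly one matrix in qʳ
-- satisfies x A = y, so a given (k+1)-dimensional U, with at most 2qᵏ points, meets the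
-- graph of a random A with probability at most 2qᵏ⁻ʳ = 2q⁻ʰ, and the graphs of a given
-- and a random matrix meet with probability at most q⁻ʰ.  Matrices are picked greedily,
-- disjoint from the earlier ones, so as to keep the potential Σ_U x ^ #{i : U meets Fᵢ}
-- small; as long as 8xM ≤ qʰ, after M steps it is at most twice the number of U, hence
-- below x ^ (L+1) for a suitable x, so that no U meets more than L members.  Counting the
-- U by reduced echelon forms gives at most 2ⁿ q ^ ((k+1)(r-1)) of them, a factor of
-- q ^ (k+1) less than what the exponent (n-k)(k+1)/(L+1) allows; this absorbs all the
-- constants once q is large.
--
-- For the second claim the maximum over all families must exist: having an AS family of
-- size m is decidable by a finite search over bases.

module Submission where

open import Defs
open import Data.Nat.Base hiding (_/_)
open import Data.Integer.Base as ℤ using (ℤ; -[1+_]; 0ℤ; 1ℤ)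
open import Data.Rational.Base as ℚ using (ℚ; 0ℚ; 1ℚ; _/_; ↥_; ↧_; ↧ₙ_; toℚᵘ)
open import Data.Product.Base
open import Algebra.Apartness.Bundles using (HeytingField)
open import Algebra.Bundles using (CommutativeSemigroup; RawRing)
open import Algebra.Definitions using (Invertible)
open import Algebra.Definitions.RawSemiring ℚ.+-*-rawSemiring using () renaming (_^_ to _^ℚ_)
open import Algebra.Morphism.Structures using (IsRingMonomorphism)
open import Algebra.Structures using (IsCommutativeRing)
open import Data.Fin.Base as Fin using (Fin; zero; suc; toℕ; fromℕ<)
open import Data.Fin.Subset as Subset using (Subset; inside; outside)
open import Data.Integer.DivMod using (_%ℕ_; _/ℕ_; n%ℕd<d; a≡a%ℕn+[a/ℕn]*n)
open import Data.List.Base as List using (List; []; _∷_; length; filter; cartesianProductWith; allFin)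
open import Data.List.Membership.Propositional using (_∈_; lose)
open import Data.List.Membership.Propositional.Properties using (∈-filter⁻; ∈-cartesianProductWith⁺; ∈-map⁺; ∈-++⁺ˡ; ∈-++⁺ʳ; ∈-allFin)
open import Data.List.Relation.Unary.All as ListAll using ([]; _∷_)
open import Data.List.Relation.Unary.AllPairs using ([]; _∷_)
open import Data.List.Relation.Unary.Any as Any using (Any; here; there; any?)
open import Data.List.Relation.Unary.Unique.Propositional using (Unique)
open import Data.List.Relation.Unary.Unique.Propositional.Properties using (cartesianProductWith⁺; allFin⁺)
open import Data.Nat.Coprimality using (prime⇒coprime; coprime-Bézout)
open import Data.Nat.Divisibility using (_∣_; ∣-trans; m∣m*n; ∣m+n∣m⇒∣n; m≤n⇒m!∣n!; ∣1⇒≡1)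
open import Data.Nat.GCD using (module Bézout)
open import Data.Nat.ListAction using (product)
open import Data.Nat.Primality using (Prime; prime⇒nonZero; prime⇒nonTrivial)
open import Data.Nat.Primality.Factorisation using (factorise)
open import Data.Nat.Properties
open import Data.Nat.Tactic.RingSolver using (solve-∀)
open import Data.Rational.Unnormalised.Base as ℚᵘ using (mkℚᵘ; *≡*; *≤*; *<*)
open import Data.Sum.Base using (_⊎_; inj₁; inj₂)
open import Data.Vec.Base as Vec using (Vec; []; _∷_; _++_; lookup; replicate; zipWith; tabulate; take; drop; count; toList)
open import Data.Vec.Relation.Unary.All as All using (All; []; _∷_)
open import Function.Base using (_∘_; id)
open import Function.Bundles using (Inverse)
open import Level using (Level; 0ℓ)
open import Relation.Binary.Definitions using (DecidableEquality)
open import Relation.Binary.PropositionalEquality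
open import Relation.Nullary using (Dec; yes; no; ¬_; ¬?; contradiction; _×-dec_; _→-dec_)
open import Relation.Nullary.Decidable using (map′)
open import Relation.Unary using (Pred; Decidable)
import Algebra.Morphism.RingMonomorphism as RingMonomorphism
import Algebra.Properties.CommutativeSemigroup
import Algebra.Properties.Ring
import Data.Fin.Properties as Fin
import Data.Integer.Properties as ℤ
import Data.Integer.Tactic.RingSolver as ℤ
import Data.List.Properties as List
import Data.List.Relation.Unary.Any.Properties as Any
import Data.Rational.Properties as ℚ
import Data.Rational.Unnormalised.Properties as ℚᵘ
import Data.Vec.Membership.Propositional.Properties as VecMembership
import Data.Vec.Properties as Vec

-- The definitions speak of predicates over an arbitrary setoid field, which cannot be listed.
-- Everything is carried over to matrices over `Fin q`, where quantifiers range over finite lists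
-- and probabilities become integer sums. The transfer goes in both directions, because a maximum is
-- compared with all abstract families. The slack in the number of U enters M only through x, so it
-- is worth q ^ ((k+1)/(L+1)), possibly far less than q. Hence U is tested on one vector per line:
-- testing all its nonzero vectors would cost a factor of about q in M itself. No constant may
-- survive in front of the power of q either, so M is the integer part of the target plus one; the
-- size is then at least the target itself and δ is 0 for large q. Real powers never appear: the
-- bound is kept as an inequality between (L+1)-st powers of natural numbers until rational
-- exponents are compared at the end. The limsup asks only for arbitrarily large q, so it is
-- witnessed by fields of prime order.

private variable
  ℓ ℓ′ : Level
  A B C : Set ℓ
  X Y : Set ℓ

-- Finite sums over lists

∑ : List A → (A → ℕ) → ℕ
∑ []       f = 0
∑ (x ∷ xs) f = f x + ∑ xs f

∑-mono : ∀ {f g : A → ℕ} xs → (∀ x → f x ≤ g x) → ∑ xs f ≤ ∑ xs g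
∑-mono []       f≤g = z≤n
∑-mono (x ∷ xs) f≤g = +-mono-≤ (f≤g x) (∑-mono xs f≤g)

∑-cong : ∀ {f g : A → ℕ} xs → (∀ x → f x ≡ g x) → ∑ xs f ≡ ∑ xs g
∑-cong []       f≡g = refl
∑-cong (x ∷ xs) f≡g = cong₂ _+_ (f≡g x) (∑-cong xs f≡g)

∑-distrib-+ : ∀ (f g : A → ℕ) xs → ∑ xs (λ x → f x + g x) ≡ ∑ xs f + ∑ xs g
∑-distrib-+ f g []       = refl
∑-distrib-+ f g (x ∷ xs) rewrite ∑-distrib-+ f g xs = interchange (f x) (g x) (∑ xs f) (∑ xs g)
  where
  interchange : ∀ a b c d → a + b + (c + d) ≡ a + c + (b + d)
  interchange = solve-∀

*-distribˡ-∑ : ∀ c (f : A → ℕ) xs → ∑ xs (λ x → c * f x) ≡ c * ∑ xs f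
*-distribˡ-∑ c f []       = sym (*-zeroʳ c)
*-distribˡ-∑ c f (x ∷ xs) =
  trans (cong (c * f x +_) (*-distribˡ-∑ c f xs)) (sym (*-distribˡ-+ c (f x) (∑ xs f)))

*-distribʳ-∑ : ∀ c (f : A → ℕ) xs → ∑ xs (λ x → f x * c) ≡ ∑ xs f * c
*-distribʳ-∑ c f []       = refl
*-distribʳ-∑ c f (x ∷ xs) =
  trans (cong (f x * c +_) (*-distribʳ-∑ c f xs)) (sym (*-distribʳ-+ c (f x) (∑ xs f)))

∑-const : ∀ c (xs : List A) → ∑ xs (λ _ → c) ≡ length xs * c
∑-const c []       = refl
∑-const c (x ∷ xs) = cong (c +_) (∑-const c xs)

∑-swap : ∀ (f : A → B → ℕ) xs ys → ∑ xs (λ x → ∑ ys (f x)) ≡ ∑ ys (λ y → ∑ xs (λ x → f x y))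
∑-swap f []       ys = sym (trans (∑-const 0 ys) (*-zeroʳ (length ys)))
∑-swap f (x ∷ xs) ys =
  trans (cong (∑ ys (f x) +_) (∑-swap f xs ys)) (sym (∑-distrib-+ (f x) _ ys))

∑-++ : ∀ (f : A → ℕ) xs ys → ∑ (xs List.++ ys) f ≡ ∑ xs f + ∑ ys f
∑-++ f []       ys = refl
∑-++ f (x ∷ xs) ys = trans (cong (f x +_) (∑-++ f xs ys)) (sym (+-assoc (f x) _ _))

∑-map : ∀ (f : B → ℕ) (g : A → B) xs → ∑ (List.map g xs) f ≡ ∑ xs (f ∘ g)
∑-map f g []       = refl
∑-map f g (x ∷ xs) = cong (f (g x) +_) (∑-map f g xs)

∑-cartesianProductWith : ∀ (f : C → ℕ) (g : A → B → C) xs ys →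
  ∑ (cartesianProductWith g xs ys) f ≡ ∑ xs (λ x → ∑ ys (λ y → f (g x y)))
∑-cartesianProductWith f g []       ys = refl
∑-cartesianProductWith f g (x ∷ xs) ys =
  trans (∑-++ f (List.map (g x) ys) _)
        (cong₂ _+_ (∑-map f (g x) ys) (∑-cartesianProductWith f g xs ys))

∈⇒≤∑ : ∀ (f : A → ℕ) {x xs} → x ∈ xs → f x ≤ ∑ xs f
∈⇒≤∑ f (here refl) = m≤m+n _ _
∈⇒≤∑ f (there x∈)  = ≤-trans (∈⇒≤∑ f x∈) (m≤n+m _ _)

𝟙 : Dec X → ℕ
𝟙 (yes _) = 1
𝟙 (no  _) = 0

𝟙-false : (p : Dec X) → ¬ X → 𝟙 p ≡ 0
𝟙-false (yes p) ¬p = contradiction p ¬p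
𝟙-false (no  _) ¬p = refl

𝟙-mono : (p : Dec X) (q : Dec Y) → (X → Y) → 𝟙 p ≤ 𝟙 q
𝟙-mono (yes p) (yes _) f = ≤-refl
𝟙-mono (yes p) (no ¬q) f = contradiction (f p) ¬q
𝟙-mono (no  _) q       f = z≤n

-- The union bound for a single outcome; summed over the pool it bounds the chance of a hit or a
-- clash. `X` is kept apart from `Any R xs` so that the induction can shorten the list while the
-- decided proposition stays fixed.
𝟙-any : ∀ {R : Pred A ℓ} (R? : Decidable R) xs (p : Dec X) → (X → Any R xs) → 𝟙 p ≤ ∑ xs (𝟙 ∘ R?)
𝟙-any R? xs       (no  _) f = z≤n
𝟙-any R? []       (yes p) f with () ← f p
𝟙-any R? (x ∷ xs) (yes p) f with R? x
... | yes _ = s≤s z≤n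
... | no ¬r = 𝟙-any R? xs (yes p) (λ p′ → Any.tail ¬r (f p′))

length-filter-¬ : ∀ {R : Pred A ℓ} (R? : Decidable R) xs →
  length (filter (¬? ∘ R?) xs) + ∑ xs (𝟙 ∘ R?) ≡ length xs
length-filter-¬ R? []       = refl
length-filter-¬ R? (x ∷ xs) with R? x
... | yes _ = trans (+-suc _ _) (cong suc (length-filter-¬ R? xs))
... | no  _ = cong suc (length-filter-¬ R? xs)

∑-filter-≤ : ∀ {R : Pred A ℓ} (R? : Decidable R) (f : A → ℕ) xs → ∑ (filter R? xs) f ≤ ∑ xs f
∑-filter-≤ R? f []       = z≤n
∑-filter-≤ R? f (x ∷ xs) with R? x
... | yes _ = +-monoʳ-≤ (f x) (∑-filter-≤ R? f xs)
... | no  _ = ≤-trans (∑-filter-≤ R? f xs) (m≤n+m _ (f x))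

∃-below-average : ∀ (f : A → ℕ) xs → 0 < length xs → ∃[ x ] x ∈ xs × length xs * f x ≤ ∑ xs f
∃-below-average f (x ∷ [])     _ = x , here refl , ≤-refl
∃-below-average f (x ∷ y ∷ ys) _ with ∃-below-average f (y ∷ ys) (s≤s z≤n)
... | z , z∈ , below with f x ≤? f z
...   | yes fx≤fz = x , here refl ,
  +-monoʳ-≤ (f x) (≤-trans (*-monoʳ-≤ (suc (length ys)) fx≤fz) below)
...   | no  fx≰fz = z , there z∈ , +-mono-≤ (≰⇒≥ fx≰fz) below

∑-𝟙-false : ∀ {R : Pred A ℓ} (R? : Decidable R) xs → (∀ x → ¬ R x) → ∑ xs (𝟙 ∘ R?) ≡ 0
∑-𝟙-false R? []       ¬R = refl
∑-𝟙-false R? (x ∷ xs) ¬R = cong₂ _+_ (𝟙-false (R? x) (¬R x)) (∑-𝟙-false R? xs ¬R)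

-- The greedy choice

count-∷ : ∀ {a p} {A : Set a} {P : Pred A p} (P? : Decidable P) x {n} (xs : Vec A n) →
  count P? (x ∷ xs) ≡ 𝟙 (P? x) + count P? xs
count-∷ P? x xs with P? x
... | yes _ = refl
... | no  _ = refl

module Greedy
  {A T : Set} (Ω : List A) (τs : List T)
  {Hits : T → A → Set} (hits? : ∀ t a → Dec (Hits t a))
  {Clash : A → A → Set} (clash? : ∀ a b → Dec (Clash a b)) (clash-sym : ∀ {a b} → Clash a b → Clash b a)
  (H x : ℕ)
  (hits-bound  : ∀ t → ∑ Ω (λ a → 𝟙 (hits? t a)) * H ≤ 2 * length Ω)
  (clash-bound : ∀ b → ∑ Ω (λ a → 𝟙 (clash? a b)) * H ≤ length Ω)
  (0<Ω : 0 < length Ω)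
  where

  private
    N = length Ω

  weight : ∀ {j} → Vec A j → T → ℕ
  weight as t = x ^ count (hits? t) as

  potential : ∀ {j} → Vec A j → ℕ
  potential as = ∑ τs (weight as)

  increment : ∀ {j} → Vec A j → A → ℕ
  increment as a = ∑ τs λ t → 𝟙 (hits? t a) * (x * weight as t)

  -- A hit multiplies the weight by x; adding x times the weight rather than x - 1 times avoids
  -- subtraction.
  weight-∷ : ∀ {j} a (as : Vec A j) t →
    weight (a ∷ as) t ≤ weight as t + 𝟙 (hits? t a) * (x * weight as t)
  weight-∷ a as t rewrite count-∷ (hits? t) a as with hits? t a
  ... | yes _ = ≤-trans (≤-reflexive (sym (+-identityʳ _))) (m≤n+m _ (weight as t))
  ... | no  _ = m≤m+n _ 0

  potential-∷ : ∀ {j} a (as : Vec A j) → potential (a ∷ as) ≤ potential as + increment as a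
  potential-∷ a as = ≤-trans (∑-mono τs (weight-∷ a as)) (≤-reflexive (∑-distrib-+ _ _ τs))

  open ≤-Reasoning

  -- Exchanging the sums turns the average over the pool into one hit probability for each t, at
  -- most 2 / H.
  total-increment : ∀ {j} (as : Vec A j) → ∑ Ω (increment as) * H ≤ 2 * N * (x * potential as)
  total-increment as = begin
    ∑ Ω (increment as) * H
      ≡⟨ cong (_* H) (∑-swap _ Ω τs) ⟩
    ∑ τs (λ t → ∑ Ω λ a → 𝟙 (hits? t a) * (x * weight as t)) * H
      ≡⟨ *-distribʳ-∑ H _ τs ⟨
    ∑ τs (λ t → ∑ Ω (λ a → 𝟙 (hits? t a) * (x * weight as t)) * H)
      ≤⟨ ∑-mono τs (λ t → begin
        ∑ Ω (λ a → 𝟙 (hits? t a) * (x * weight as t)) * H ≡⟨ cong (_* H) (*-distribʳ-∑ _ _ Ω) ⟩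
        ∑ Ω (λ a → 𝟙 (hits? t a)) * (x * weight as t) * H ≡⟨ swap-last (∑ Ω λ a → 𝟙 (hits? t a)) _ H ⟩
        ∑ Ω (λ a → 𝟙 (hits? t a)) * H * (x * weight as t) ≤⟨ *-monoˡ-≤ _ (hits-bound t) ⟩
        2 * N * (x * weight as t)                         ∎) ⟩
    ∑ τs (λ t → 2 * N * (x * weight as t))
      ≡⟨ *-distribˡ-∑ (2 * N) _ τs ⟩
    2 * N * ∑ τs (λ t → x * weight as t)
      ≡⟨ cong (2 * N *_) (*-distribˡ-∑ x _ τs) ⟩
    2 * N * (x * potential as) ∎
    where
    swap-last : ∀ a b c → a * b * c ≡ a * c * b
    swap-last = solve-∀

  clashes? : ∀ {j} (as : Vec A j) a → Dec (Any (Clash a) (toList as))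
  clashes? as a = any? (clash? a) (toList as)

  clashes-bound : ∀ {j} (as : Vec A j) → ∑ Ω (λ a → 𝟙 (clashes? as a)) * H ≤ j * N
  clashes-bound {j} as = begin
    ∑ Ω (λ a → 𝟙 (clashes? as a)) * H
      ≤⟨ *-monoˡ-≤ H (∑-mono Ω λ a → 𝟙-any (clash? a) (toList as) (clashes? as a) id) ⟩
    ∑ Ω (λ a → ∑ (toList as) λ b → 𝟙 (clash? a b)) * H
      ≡⟨ cong (_* H) (∑-swap _ Ω (toList as)) ⟩
    ∑ (toList as) (λ b → ∑ Ω λ a → 𝟙 (clash? a b)) * H
      ≡⟨ *-distribʳ-∑ H _ (toList as) ⟨
    ∑ (toList as) (λ b → ∑ Ω (λ a → 𝟙 (clash? a b)) * H)
      ≤⟨ ∑-mono (toList as) clash-bound ⟩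
    ∑ (toList as) (λ _ → N)
      ≡⟨ ∑-toList as ⟩
    j * N ∎
    where
    ∑-toList : ∀ {j} (as : Vec A j) → ∑ (toList as) (λ _ → N) ≡ j * N
    ∑-toList []       = refl
    ∑-toList (a ∷ as) = cong (N +_) (∑-toList as)

  Clashless : ∀ {j} → Vec A j → Set
  Clashless as = ∀ {i i′} → i ≢ i′ → ¬ Clash (lookup as i) (lookup as i′)

  module _ {M : ℕ} (0<M : 0 < M) (0<x : 0 < x) (8xM≤H : 8 * (x * M) ≤ H) where

    private
      2M≤H : 2 * M ≤ H
      2M≤H = begin
        2 * M       ≤⟨ *-mono-≤ {2} {8 * x} (*-mono-≤ {2} {8} (s≤s (s≤s z≤n)) 0<x) ≤-refl ⟩
        8 * x * M   ≡⟨ *-assoc 8 x M ⟩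
        8 * (x * M) ≤⟨ 8xM≤H ⟩
        H           ∎

      0<H : 0 < H
      0<H = ≤-trans 0<M (≤-trans (m≤m+n M _) 2M≤H)

      instance
        H-nonZero : NonZero H
        H-nonZero = >-nonZero 0<H
        N-nonZero : NonZero N
        N-nonZero = >-nonZero 0<Ω
        4x-nonZero : NonZero (4 * x)
        4x-nonZero = >-nonZero (*-mono-≤ {1} {4} {1} (s≤s z≤n) 0<x)

    unclashed : ∀ {j} → Vec A j → List A
    unclashed as = filter (¬? ∘ clashes? as) Ω

    -- Each of the j earlier choices excludes at most a fraction 1 / H of the pool, and 2j ≤ 2M ≤ H.
    half-unclashed : ∀ {j} (as : Vec A j) → j ≤ M → N ≤ 2 * length (unclashed as)
    half-unclashed {j} as j≤M = *-cancelʳ-≤ N (2 * g) H (+-cancelʳ-≤ (H * N) (N * H) (2 * g * H) (begin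
        N * H + H * N             ≡⟨ double N H ⟩
        2 * (H * N)               ≡⟨ cong (λ z → 2 * (H * z)) (length-filter-¬ (clashes? as) Ω) ⟨
        2 * (H * (g + bad))       ≡⟨ expand g bad H ⟩
        2 * g * H + 2 * (bad * H) ≤⟨ +-monoʳ-≤ (2 * g * H) (*-monoʳ-≤ 2 (clashes-bound as)) ⟩
        2 * g * H + 2 * (j * N)   ≤⟨ +-monoʳ-≤ (2 * g * H) (*-monoʳ-≤ 2 (*-monoˡ-≤ N j≤M)) ⟩
        2 * g * H + 2 * (M * N)   ≡⟨ cong (2 * g * H +_) (*-assoc 2 M N) ⟨
        2 * g * H + 2 * M * N     ≤⟨ +-monoʳ-≤ (2 * g * H) (*-monoˡ-≤ N 2M≤H) ⟩
        2 * g * H + H * N         ∎))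
      where
      g   = length (unclashed as)
      bad = ∑ Ω (λ a → 𝟙 (clashes? as a))
      double : ∀ a b → a * b + b * a ≡ 2 * (b * a)
      double = solve-∀
      expand : ∀ a b c → 2 * (c * (a + b)) ≡ 2 * a * c + 2 * (b * c)
      expand = solve-∀

    -- At most half of the pool clashes with as, so some clash-free a has an increment
    -- of at most twice the average over the whole pool.
    good-choice : ∀ {j} (as : Vec A j) → j ≤ M →
      ∃[ a ] ¬ Any (Clash a) (toList as) × 2 * M * increment as a ≤ potential as
    good-choice {j} as j≤M =
      let a , a∈ , below = ∃-below-average (increment as) (unclashed as) 0<g
      in a , proj₂ (∈-filter⁻ (¬? ∘ clashes? as) {xs = Ω} a∈) , bound (increment as a) below
      where
      g = length (unclashed as)
      Φ = potential as

      0<g : 0 < g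
      0<g = n≢0⇒n>0 λ g≡0 → <⇒≱ 0<Ω (subst (λ z → N ≤ 2 * z) g≡0 (half-unclashed as j≤M))

      -- Origin of the 8: a 2 for the halved pool and a 2 from `hits-bound` make the increment at
      -- most 4xΦ / H, and the last 2 is that of 2M.
      bound : ∀ inc → g * inc ≤ ∑ (unclashed as) (increment as) → 2 * M * inc ≤ Φ
      bound inc below = *-cancelˡ-≤ (4 * x) (*-cancelˡ-≤ N (begin
        N * (4 * x * (2 * M * inc))  ≡⟨ e₁ N x M inc ⟩
        N * inc * (8 * (x * M))      ≤⟨ *-monoʳ-≤ (N * inc) 8xM≤H ⟩
        N * inc * H                  ≤⟨ *-monoˡ-≤ H (*-monoˡ-≤ inc (half-unclashed as j≤M)) ⟩
        2 * g * inc * H              ≡⟨ cong (_* H) (*-assoc 2 g inc) ⟩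
        2 * (g * inc) * H            ≤⟨ *-monoˡ-≤ H (*-monoʳ-≤ 2 (≤-trans below (∑-filter-≤ (¬? ∘ clashes? as) (increment as) Ω))) ⟩
        2 * ∑ Ω (increment as) * H   ≡⟨ *-assoc 2 (∑ Ω (increment as)) H ⟩
        2 * (∑ Ω (increment as) * H) ≤⟨ *-monoʳ-≤ 2 (total-increment as) ⟩
        2 * (2 * N * (x * Φ))        ≡⟨ e₂ N x Φ ⟩
        N * (4 * x * Φ)              ∎))
        where
        e₁ : ∀ a b c d → a * (4 * b * (2 * c * d)) ≡ a * d * (8 * (b * c))
        e₁ = solve-∀
        e₂ : ∀ a b c → 2 * (2 * a * (b * c)) ≡ a * (4 * b * c)
        e₂ = solve-∀

    -- The factor (M + i) / 2M decreases fast enough to absorb the growth (2M + 1) / 2M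
    -- of the potential Φ in each of the M steps.
    absorb : ∀ {i Φ Φ′ inc T} → i ≤ M → Φ′ ≤ Φ + inc → 2 * M * inc ≤ Φ →
      (M + suc i) * Φ ≤ T → (M + i) * Φ′ ≤ T
    absorb {i} {Φ} {Φ′} {inc} {T} i≤M Φ′≤ inc≤ small =
      *-cancelˡ-≤ (2 * M) {{>-nonZero (≤-trans 0<M (m≤m+n M _))}} (begin
        2 * M * ((M + i) * Φ′)             ≡⟨ e₁ M (M + i) Φ′ ⟩
        (M + i) * (2 * M * Φ′)             ≤⟨ *-monoʳ-≤ (M + i) (*-monoʳ-≤ (2 * M) Φ′≤) ⟩
        (M + i) * (2 * M * (Φ + inc))      ≡⟨ cong ((M + i) *_) (*-distribˡ-+ (2 * M) Φ inc) ⟩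
        (M + i) * (2 * M * Φ + 2 * M * inc) ≤⟨ *-monoʳ-≤ (M + i) (+-monoʳ-≤ (2 * M * Φ) inc≤) ⟩
        (M + i) * (2 * M * Φ + Φ)          ≡⟨ e₂ M i Φ ⟩
        2 * M * (M + i) * Φ + (M + i) * Φ  ≤⟨ +-monoʳ-≤ (2 * M * (M + i) * Φ) (*-monoˡ-≤ Φ (+-monoʳ-≤ M i≤M)) ⟩
        2 * M * (M + i) * Φ + (M + M) * Φ  ≡⟨ e₃ M i Φ ⟩
        2 * M * ((M + suc i) * Φ)          ≤⟨ *-monoʳ-≤ (2 * M) small ⟩
        2 * M * T                          ∎)
      where
      e₁ : ∀ a b c → 2 * a * (b * c) ≡ b * (2 * a * c)
      e₁ = solve-∀
      e₂ : ∀ a b c → (a + b) * (2 * a * c + c) ≡ 2 * a * (a + b) * c + (a + b) * c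
      e₂ = solve-∀
      e₃ : ∀ a b c → 2 * a * (a + b) * c + (a + a) * c ≡ 2 * a * ((a + (1 + b)) * c)
      e₃ = solve-∀

    -- Here i counts the steps still to come. The invariant is an equality at i = M, where every
    -- weight is 1; at i = 0 it says that the potential is at most twice the number of tests.
    greedy : ∀ j i → j + i ≡ M →
      ∃[ as ] Clashless {j} as × (M + i) * potential as ≤ 2 * M * length τs
    greedy zero i eq = [] , (λ { {()} }) , ≤-reflexive (begin-equality
      (M + i) * potential [] ≡⟨ cong₂ _*_ (cong (M +_) (trans eq (sym (+-identityʳ M)))) (trans (∑-const 1 τs) (*-identityʳ _)) ⟩
      2 * M * length τs      ∎)
    greedy (suc j) i eq =
      let as , clashless , small = greedy j (suc i) (trans (+-suc j i) eq)
          a , a-ok , inc-ok      = good-choice as (subst (j ≤_) eq (m≤n⇒m≤1+n (m≤m+n j i)))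
      in a ∷ as , extend a-ok clashless ,
         absorb (subst (i ≤_) eq (m≤n+m i (suc j))) (potential-∷ a as) inc-ok small
      where
      extend : ∀ {a} {as : Vec A j} → ¬ Any (Clash a) (toList as) → Clashless as → Clashless (a ∷ as)
      extend {a} {as} a-ok clashless {zero}  {zero}   i≢i′ = contradiction refl i≢i′
      extend {a} {as} a-ok clashless {zero}  {suc i′} _ c  = a-ok (lose (VecMembership.∈-toList⁺ (VecMembership.∈-lookup i′ as)) c)
      extend {a} {as} a-ok clashless {suc i} {zero}   _ c  = a-ok (lose (VecMembership.∈-toList⁺ (VecMembership.∈-lookup i as)) (clash-sym c))
      extend {a} {as} a-ok clashless {suc i} {suc i′} i≢i′ = clashless (i≢i′ ∘ cong suc)

    ∃-sparse : ∀ {L} → 2 * length τs < x ^ suc L →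
      ∃[ as ] Clashless {M} as × (∀ {t} → t ∈ τs → count (hits? t) as ≤ L)
    ∃-sparse {L} big =
      let as , clashless , small = greedy M 0 (+-identityʳ M)
      -- With more than L hits, the weight of t alone would be at least x ^ (L+1), more than the
      -- whole potential.
      in as , clashless , λ {t} t∈ → ≮⇒≥ λ L<c → <⇒≱ big (begin
        x ^ suc L              ≤⟨ ^-monoʳ-≤ x {{>-nonZero 0<x}} L<c ⟩
        x ^ count (hits? t) as ≤⟨ ∈⇒≤∑ (weight as) t∈ ⟩
        potential as           ≤⟨ *-cancelˡ-≤ M {{>-nonZero 0<M}} (begin
          M * potential as       ≡⟨ cong (_* potential as) (+-identityʳ M) ⟨
          (M + 0) * potential as ≤⟨ small ⟩
          2 * M * length τs      ≡⟨ e M (length τs) ⟩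
          M * (2 * length τs)    ∎) ⟩
        2 * length τs          ∎)
      where
      e : ∀ a b → 2 * a * b ≡ a * (2 * b)
      e = solve-∀

-- Finite fields and vectors

-- Propositional equality on `Fin q` makes vectors a type that can be enumerated and compared, which
-- a setoid carrier does not offer directly.
record FieldOn (q : ℕ) : Set where
  infixl 6 _⊕_
  infixl 7 _⊗_
  field
    _⊕_ _⊗_ : Fin q → Fin q → Fin q
    ⊖_      : Fin q → Fin q
    0# 1#   : Fin q
    isCommutativeRing : IsCommutativeRing _≡_ _⊕_ _⊗_ ⊖_ 0# 1#
    inverse : ∀ {a} → a ≢ 0# → ∃[ b ] b ⊗ a ≡ 1#
    1≢0     : 1# ≢ 0#

  open IsCommutativeRing isCommutativeRing public
    using (+-assoc; +-comm; +-identityˡ; +-identityʳ; -‿inverseˡ;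
           *-assoc; *-comm; *-identityˡ; *-identityʳ; distribˡ; distribʳ; zeroˡ; zeroʳ)

module Transport {q : ℕ} (K : FiniteField q) where
  private
    module K = FiniteField K
    module H = HeytingField K.heytingField
  open Inverse K.enumeration public using (to; from; to-cong; from-cong)

  to∘from : ∀ i → to (from i) ≡ i
  to∘from i = Inverse.inverseˡ K.enumeration K.refl

  from∘to : ∀ a → from (to a) K.≈ a
  from∘to a = Inverse.inverseʳ K.enumeration refl

  to-injective : ∀ {a b} → to a ≡ to b → a K.≈ b
  to-injective {a} {b} eq = K.trans (K.sym (from∘to a)) (K.trans (from-cong eq) (from∘to b))

  from-injective : ∀ {i j} → from i K.≈ from j → i ≡ j
  from-injective {i} {j} eq = trans (sym (to∘from i)) (trans (to-cong eq) (to∘from j))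

  rawRing : RawRing 0ℓ 0ℓ
  rawRing = record
    { Carrier = Fin q
    ; _≈_ = _≡_
    ; _+_ = λ i j → to (from i K.+ from j)
    ; _*_ = λ i j → to (from i K.* from j)
    ; -_  = λ i → to (K.- from i)
    ; 0#  = to K.0#
    ; 1#  = to K.1#
    }

  open RawRing rawRing using (0#; 1#) renaming (_+_ to _⊕_; _*_ to _⊗_)

  from-isRingMonomorphism : IsRingMonomorphism rawRing K.rawRing from
  from-isRingMonomorphism = record
    { isRingHomomorphism = record
      { isSemiringHomomorphism = record
        { isNearSemiringHomomorphism = record
          { +-isMonoidHomomorphism = record
            { isMagmaHomomorphism = record
              { isRelHomomorphism = record { cong = from-cong }
              ; homo = λ _ _ → from∘to _
              }
            ; ε-homo = from∘to _
            }
          ; *-homo = λ _ _ → from∘to _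
          }
        ; 1#-homo = from∘to _
        }
      ; -‿homo = λ _ → from∘to _
      }
    ; injective = from-injective
    }

  to-+ : ∀ a b → to (a K.+ b) ≡ to a ⊕ to b
  to-+ a b = to-cong (K.+-cong (K.sym (from∘to a)) (K.sym (from∘to b)))

  to-* : ∀ a b → to (a K.* b) ≡ to a ⊗ to b
  to-* a b = to-cong (K.*-cong (K.sym (from∘to a)) (K.sym (from∘to b)))

  -- Were 1 equal to 0, all elements would coincide, so 0 - 0 would be invertible and 0 apart from
  -- itself.
  1≢0 : 1# ≢ 0#
  1≢0 1≡0 = H.#-irrefl K.refl (H.invertible⇒# {K.0#} {K.0#} (K.0# , trivial , trivial))
    where
    1≈0 : K.1# K.≈ K.0#
    1≈0 = to-injective 1≡0
    trivial : ∀ {a} → a K.≈ K.1#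
    trivial {a} = K.trans (K.trans (K.sym (K.*-identityˡ a)) (K.*-congʳ 1≈0))
      (K.trans (K.zeroˡ a) (K.sym 1≈0))

  -- Apartness from 0 is not known to be decidable, so the inverse is found by search;
  -- if there is none, tightness forces a ≡ 0.
  inverse : ∀ {a} → a ≢ 0# → ∃[ b ] b ⊗ a ≡ 1#
  inverse {a} a≢0 with Fin.any? (λ b → b ⊗ a Fin.≟ 1#)
  ... | yes found = found
  ... | no  none  = contradiction a≡0 a≢0
    where
    a≈0 : from a K.≈ K.0#
    a≈0 = proj₁ (H.tight (from a) K.0#) λ a#0 →
      let b , ba≈1 , _ = H.#⇒invertible a#0
          a-0≈a = K.trans (K.+-congˡ (Algebra.Properties.Ring.-0#≈0# K.ring)) (K.+-identityʳ (from a))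
      in none (to b , to-cong (K.trans (K.*-cong (from∘to b) (K.sym a-0≈a)) ba≈1))
    a≡0 : a ≡ 0#
    a≡0 = trans (sym (to∘from a)) (to-cong a≈0)

  fieldOn : FieldOn q
  fieldOn = record
    { isCommutativeRing = RingMonomorphism.isCommutativeRing from-isRingMonomorphism K.isCommutativeRing
    ; inverse = inverse
    ; 1≢0 = 1≢0
    }

module Vectors {q : ℕ} (𝔽 : FieldOn q) where
  private
    module F = FieldOn 𝔽
  open F using (0#; 1#; _⊕_; _⊗_; ⊖_)

  private variable
    c d m n : ℕ

  Vect : ℕ → Set
  Vect = Vec (Fin q)

  infixl 6 _+ᵛ_
  infixr 7 _·ᵛ_

  0ᵛ : Vect n
  0ᵛ = replicate _ 0#

  _+ᵛ_ : Vect n → Vect n → Vect n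
  _+ᵛ_ = zipWith _⊕_

  _·ᵛ_ : Fin q → Vect n → Vect n
  a ·ᵛ v = Vec.map (a ⊗_) v

  +ᵛ-assoc : ∀ (u v w : Vect n) → (u +ᵛ v) +ᵛ w ≡ u +ᵛ (v +ᵛ w)
  +ᵛ-assoc = Vec.zipWith-assoc F.+-assoc

  +ᵛ-comm : ∀ (u v : Vect n) → u +ᵛ v ≡ v +ᵛ u
  +ᵛ-comm = Vec.zipWith-comm F.+-comm

  +ᵛ-identityˡ : ∀ (v : Vect n) → 0ᵛ +ᵛ v ≡ v
  +ᵛ-identityˡ = Vec.zipWith-identityˡ F.+-identityˡ

  +ᵛ-identityʳ : ∀ (v : Vect n) → v +ᵛ 0ᵛ ≡ v
  +ᵛ-identityʳ = Vec.zipWith-identityʳ F.+-identityʳ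

  +ᵛ-commutativeSemigroup : ℕ → CommutativeSemigroup _ _
  +ᵛ-commutativeSemigroup n = record
    { Carrier = Vect n
    ; isCommutativeSemigroup = record
      { isSemigroup = record
        { isMagma = record { isEquivalence = isEquivalence ; ∙-cong = cong₂ _+ᵛ_ }
        ; assoc = +ᵛ-assoc
        }
      ; comm = +ᵛ-comm
      }
    }

  +ᵛ-interchange : ∀ (u v w x : Vect n) → (u +ᵛ v) +ᵛ (w +ᵛ x) ≡ (u +ᵛ w) +ᵛ (v +ᵛ x)
  +ᵛ-interchange {n} = Algebra.Properties.CommutativeSemigroup.interchange (+ᵛ-commutativeSemigroup n)

  ·ᵛ-distribˡ : ∀ a (u v : Vect n) → a ·ᵛ (u +ᵛ v) ≡ a ·ᵛ u +ᵛ a ·ᵛ v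
  ·ᵛ-distribˡ a []      []      = refl
  ·ᵛ-distribˡ a (x ∷ u) (y ∷ v) = cong₂ _∷_ (F.distribˡ a x y) (·ᵛ-distribˡ a u v)

  ·ᵛ-distribʳ : ∀ a b (v : Vect n) → (a ⊕ b) ·ᵛ v ≡ a ·ᵛ v +ᵛ b ·ᵛ v
  ·ᵛ-distribʳ a b []      = refl
  ·ᵛ-distribʳ a b (x ∷ v) = cong₂ _∷_ (F.distribʳ x a b) (·ᵛ-distribʳ a b v)

  ·ᵛ-assoc : ∀ a b (v : Vect n) → (a ⊗ b) ·ᵛ v ≡ a ·ᵛ b ·ᵛ v
  ·ᵛ-assoc a b []      = refl
  ·ᵛ-assoc a b (x ∷ v) = cong₂ _∷_ (F.*-assoc a b x) (·ᵛ-assoc a b v)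

  ·ᵛ-identity : ∀ (v : Vect n) → 1# ·ᵛ v ≡ v
  ·ᵛ-identity []      = refl
  ·ᵛ-identity (x ∷ v) = cong₂ _∷_ (F.*-identityˡ x) (·ᵛ-identity v)

  ·ᵛ-zeroˡ : ∀ (v : Vect n) → 0# ·ᵛ v ≡ 0ᵛ
  ·ᵛ-zeroˡ []      = refl
  ·ᵛ-zeroˡ (x ∷ v) = cong₂ _∷_ (F.zeroˡ x) (·ᵛ-zeroˡ v)

  ·ᵛ-zeroʳ : ∀ a → a ·ᵛ 0ᵛ {n} ≡ 0ᵛ
  ·ᵛ-zeroʳ {zero}  a = refl
  ·ᵛ-zeroʳ {suc n} a = cong₂ _∷_ (F.zeroʳ a) (·ᵛ-zeroʳ a)

  +ᵛ-inverse : ∀ (v : Vect n) → (⊖ 1#) ·ᵛ v +ᵛ v ≡ 0ᵛ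
  +ᵛ-inverse v = begin
    (⊖ 1#) ·ᵛ v +ᵛ v        ≡⟨ cong ((⊖ 1#) ·ᵛ v +ᵛ_) (·ᵛ-identity v) ⟨
    (⊖ 1#) ·ᵛ v +ᵛ 1# ·ᵛ v  ≡⟨ ·ᵛ-distribʳ (⊖ 1#) 1# v ⟨
    ((⊖ 1#) ⊕ 1#) ·ᵛ v      ≡⟨ cong (_·ᵛ v) (F.-‿inverseˡ 1#) ⟩
    0# ·ᵛ v                 ≡⟨ ·ᵛ-zeroˡ v ⟩
    0ᵛ                      ∎
    where open ≡-Reasoning

  infixl 6 _-ᵛ_
  _-ᵛ_ : Vect n → Vect n → Vect n
  u -ᵛ v = u +ᵛ (⊖ 1#) ·ᵛ v

  -ᵛ+ᵛ : ∀ (u v : Vect n) → (u -ᵛ v) +ᵛ v ≡ u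
  -ᵛ+ᵛ u v = trans (+ᵛ-assoc u _ v) (trans (cong (u +ᵛ_) (+ᵛ-inverse v)) (+ᵛ-identityʳ u))

  +ᵛ-cancelʳ : ∀ (u v w : Vect n) → u +ᵛ w ≡ v +ᵛ w → u ≡ v
  +ᵛ-cancelʳ u v w eq = trans (sym (lemma u)) (trans (cong (_-ᵛ w) eq) (lemma v))
    where
    lemma : ∀ u → (u +ᵛ w) -ᵛ w ≡ u
    lemma u = trans (+ᵛ-assoc u w _) (trans (cong (u +ᵛ_) (trans (+ᵛ-comm w _) (+ᵛ-inverse w))) (+ᵛ-identityʳ u))

  ·ᵛ-cancel : ∀ {a b} (u : Vect n) → b ⊗ a ≡ 1# → b ·ᵛ a ·ᵛ u ≡ u
  ·ᵛ-cancel {a = a} {b} u ba≡1 = trans (sym (·ᵛ-assoc b a u)) (trans (cong (_·ᵛ u) ba≡1) (·ᵛ-identity u))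

  ·ᵛ-++ : ∀ a (u : Vect m) (v : Vect n) → a ·ᵛ (u ++ v) ≡ (a ·ᵛ u) ++ (a ·ᵛ v)
  ·ᵛ-++ a = Vec.map-++ (a ⊗_)

  +ᵛ-++ : ∀ (u u′ : Vect m) (v v′ : Vect n) → (u ++ v) +ᵛ (u′ ++ v′) ≡ (u +ᵛ u′) ++ (v +ᵛ v′)
  +ᵛ-++ []      []       v v′ = refl
  +ᵛ-++ (x ∷ u) (y ∷ u′) v v′ = cong (x ⊕ y ∷_) (+ᵛ-++ u u′ v v′)

  0ᵛ-++ : 0ᵛ {m} ++ 0ᵛ {n} ≡ 0ᵛ
  0ᵛ-++ {zero}  = refl
  0ᵛ-++ {suc m} = cong (0# ∷_) (0ᵛ-++ {m})

  infix 4 _≟ᵛ_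
  _≟ᵛ_ : (u v : Vect n) → Dec (u ≡ v)
  _≟ᵛ_ = Vec.≡-dec Fin._≟_

  -- The row vector of coefficients times the matrix with rows `us`.
  lin : Vect d → Vec (Vect n) d → Vect n
  lin []      []       = 0ᵛ
  lin (a ∷ c) (u ∷ us) = a ·ᵛ u +ᵛ lin c us

  lin-+ : ∀ (c c′ : Vect d) (us : Vec (Vect n) d) → lin (c +ᵛ c′) us ≡ lin c us +ᵛ lin c′ us
  lin-+ []      []        []       = sym (+ᵛ-identityˡ 0ᵛ)
  lin-+ (a ∷ c) (a′ ∷ c′) (u ∷ us) =
    trans (cong₂ _+ᵛ_ (·ᵛ-distribʳ a a′ u) (lin-+ c c′ us)) (+ᵛ-interchange (a ·ᵛ u) (a′ ·ᵛ u) (lin c us) (lin c′ us))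

  lin-· : ∀ a (c : Vect d) (us : Vec (Vect n) d) → lin (a ·ᵛ c) us ≡ a ·ᵛ lin c us
  lin-· a []      []       = sym (·ᵛ-zeroʳ a)
  lin-· a (b ∷ c) (u ∷ us) =
    trans (cong₂ _+ᵛ_ (·ᵛ-assoc a b u) (lin-· a c us)) (sym (·ᵛ-distribˡ a (b ·ᵛ u) (lin c us)))

  lin-0 : ∀ (us : Vec (Vect n) d) → lin 0ᵛ us ≡ 0ᵛ
  lin-0 []       = refl
  lin-0 (u ∷ us) = trans (cong₂ _+ᵛ_ (·ᵛ-zeroˡ u) (lin-0 us)) (+ᵛ-identityˡ 0ᵛ)

  lin-0∷ : ∀ (c : Vect d) (us : Vec (Vect n) d) → lin c (Vec.map (0# ∷_) us) ≡ 0# ∷ lin c us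
  lin-0∷ []      []       = refl
  lin-0∷ (a ∷ c) (u ∷ us) rewrite lin-0∷ c us =
    cong (_∷ a ·ᵛ u +ᵛ lin c us) (trans (cong (_⊕ 0#) (F.zeroʳ a)) (F.+-identityˡ 0#))

  lin-++ : ∀ (c : Vect d) (us : Vec (Vect m) d) (vs : Vec (Vect n) d) →
    lin c (zipWith _++_ us vs) ≡ lin c us ++ lin c vs
  lin-++ {m = m} []      []       []       = sym (0ᵛ-++ {m})
  lin-++ (a ∷ c) (u ∷ us) (v ∷ vs) rewrite lin-++ c us vs | ·ᵛ-++ a u v =
    +ᵛ-++ (a ·ᵛ u) (lin c us) (a ·ᵛ v) (lin c vs)

  identity : ∀ d → Vec (Vect d) d
  identity zero    = []
  identity (suc d) = (1# ∷ 0ᵛ) ∷ Vec.map (0# ∷_) (identity d)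

  lin-identity : ∀ (c : Vect d) → lin c (identity d) ≡ c
  lin-identity []      = refl
  lin-identity (a ∷ c) rewrite lin-0∷ c (identity _) | lin-identity c =
    cong₂ _∷_ (trans (F.+-identityʳ _) (F.*-identityʳ a)) (trans (cong (_+ᵛ c) (·ᵛ-zeroʳ a)) (+ᵛ-identityˡ c))

  unit : Fin d → Vect d
  unit i = lookup (identity _) i

  lin-unit : ∀ (us : Vec (Vect n) d) i → lin (unit i) us ≡ lookup us i
  lin-unit (u ∷ us) zero    = trans (cong₂ _+ᵛ_ (·ᵛ-identity u) (lin-0 us)) (+ᵛ-identityʳ u)
  lin-unit (u ∷ us) (suc i) =
    trans (cong (λ c → lin c (u ∷ us)) (Vec.lookup-map i (0# ∷_) (identity _)))
          (trans (cong₂ _+ᵛ_ (·ᵛ-zeroˡ u) (lin-unit us i)) (+ᵛ-identityˡ _))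

-- Echelon forms

length-cartesianProductWith : ∀ {A B C : Set} (f : A → B → C) xs ys →
  length (cartesianProductWith f xs ys) ≡ length xs * length ys
length-cartesianProductWith f []       ys = refl
length-cartesianProductWith f (x ∷ xs) ys =
  trans (List.length-++ (List.map (f x) ys))
        (cong₂ _+_ (List.length-map (f x) ys) (length-cartesianProductWith f xs ys))

module _ {A : Set} where

  vectors : List A → ∀ n → List (Vec A n)
  vectors xs zero    = [] ∷ []
  vectors xs (suc n) = cartesianProductWith _∷_ xs (vectors xs n)

  length-vectors : ∀ xs n → length (vectors xs n) ≡ length xs ^ n
  length-vectors xs zero    = refl
  length-vectors xs (suc n) =
    trans (length-cartesianProductWith _∷_ xs _) (cong (length xs *_) (length-vectors xs n))

  ∈-vectors : ∀ {xs} → (∀ x → x ∈ xs) → ∀ {n} (v : Vec A n) → v ∈ vectors xs n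
  ∈-vectors complete []      = here refl
  ∈-vectors complete (x ∷ v) = ∈-cartesianProductWith⁺ _∷_ (complete x) (∈-vectors complete v)

module Codes {q : ℕ} (𝔽 : FieldOn q) where
  private
    module F = FieldOn 𝔽
  open F using (0#; 1#; inverse; _⊗_)
  open Vectors 𝔽

  private variable
    c d m n : ℕ

  allVects : ∀ n → List (Vect n)
  allVects = vectors (allFin q)

  ∈-allVects : (v : Vect n) → v ∈ allVects n
  ∈-allVects = ∈-vectors ∈-allFin

  length-allVects : ∀ n → length (allVects n) ≡ q ^ n
  length-allVects n = trans (length-vectors (allFin q) n) (cong (_^ n) (List.length-tabulate id))

  Span : Vec (Vect n) d → Vect n → Set
  Span us v = ∃[ b ] v ≡ lin b us

  span-+ : ∀ {us : Vec (Vect n) d} {v w} → Span us v → Span us w → Span us (v +ᵛ w)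
  span-+ {us = us} (b , refl) (b′ , refl) = b +ᵛ b′ , sym (lin-+ b b′ us)

  span-· : ∀ {us : Vec (Vect n) d} a {v} → Span us v → Span us (a ·ᵛ v)
  span-· {us = us} a (b , refl) = a ·ᵛ b , sym (lin-· a b us)

  span-0 : ∀ {us : Vec (Vect n) d} → Span us 0ᵛ
  span-0 {us = us} = 0ᵛ , sym (lin-0 us)

  span-lin : ∀ {us : Vec (Vect n) d} {vs : Vec (Vect n) c} → All (Span us) vs → ∀ b → Span us (lin b vs)
  span-lin []       []      = span-0
  span-lin (p ∷ ps) (a ∷ b) = span-+ (span-· a p) (span-lin ps b)

  span-trans : ∀ {us : Vec (Vect n) d} {vs : Vec (Vect n) c} → All (Span us) vs → ∀ {v} → Span vs v → Span us v
  span-trans ps (b , refl) = span-lin ps b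

  span-head : ∀ {u} {us : Vec (Vect n) d} → Span (u ∷ us) u
  span-head {u = u} {us} =
    1# ∷ 0ᵛ , sym (trans (cong₂ _+ᵛ_ (·ᵛ-identity u) (lin-0 us)) (+ᵛ-identityʳ u))

  span-tail : ∀ {u} {us : Vec (Vect n) d} {v} → Span us v → Span (u ∷ us) v
  span-tail {u = u} {us} (b , refl) =
    0# ∷ b , sym (trans (cong (_+ᵛ lin b us) (·ᵛ-zeroˡ u)) (+ᵛ-identityˡ _))

  span-rows : ∀ (us : Vec (Vect n) d) → All (Span us) us
  span-rows []       = []
  span-rows (u ∷ us) = span-head ∷ All.map span-tail (span-rows us)

  span-insert : ∀ {u w} {us : Vec (Vect n) d} {v} → Span (u ∷ us) v → Span (u ∷ w ∷ us) v
  span-insert {us = us} = span-trans (span-head ∷ All.map (span-tail ∘ span-tail) (span-rows us))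

  span-0∷ : ∀ {us : Vec (Vect n) d} {v} → Span us v → Span (Vec.map (0# ∷_) us) (0# ∷ v)
  span-0∷ {us = us} (b , refl) = b , sym (lin-0∷ b us)

  span-map-0∷ : ∀ {us : Vec (Vect n) d} {vs : Vec (Vect n) c} → All (Span us) vs →
    All (Span (Vec.map (0# ∷_) us)) (Vec.map (0# ∷_) vs)
  span-map-0∷ []       = []
  span-map-0∷ (p ∷ ps) = span-0∷ p ∷ span-map-0∷ ps

  -- A d-dimensional subspace of 𝔽ⁿ of codimension c in reduced row echelon form.  The
  -- coordinates are processed from left to right; the row of a pivot is determined by its
  -- entries in the c non-pivot coordinates to its right.
  data Code : ℕ → ℕ → ℕ → Set where
    nil   : Code 0 0 0
    pivot : Code d c n → Vect c → Code (suc d) c (suc n)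
    skip  : Code d c n → Code d (suc c) (suc n)

  -- The vectors that vanish at every pivot. They form a complement of the row space, which is the
  -- point of `decompose`.
  free : Code d c n → Vect c → Vect n
  free nil         []      = []
  free (pivot C _) w       = 0# ∷ free C w
  free (skip C)    (a ∷ w) = a ∷ free C w

  rows : Code d c n → Vec (Vect n) d
  rows nil         = []
  rows (pivot C w) = (1# ∷ free C w) ∷ Vec.map (0# ∷_) (rows C)
  rows (skip C)    = Vec.map (0# ∷_) (rows C)

  decompose : ∀ (C : Code d c n) v → ∃[ g ] Span (rows C) g × ∃[ w ] v ≡ g +ᵛ free C w
  decompose nil         []      = [] , ([] , refl) , [] , refl
  decompose (skip C)    (a ∷ v) with decompose C v
  ... | g , g∈ , w , refl =
    0# ∷ g , span-0∷ g∈ , a ∷ w , cong (_∷ _) (sym (F.+-identityˡ a))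
  -- Subtracting a times the pivot row clears the first coordinate; the rest is reduced by the later
  -- rows.
  decompose (pivot C w₀) (a ∷ v) with decompose C (v -ᵛ a ·ᵛ free C w₀)
  ... | g , g∈ , w , eq =
    a ·ᵛ (1# ∷ free C w₀) +ᵛ (0# ∷ g) , span-+ (span-· a span-head) (span-tail (span-0∷ g∈)) , w ,
    cong₂ _∷_ (sym (trans (F.+-identityʳ _) (trans (F.+-identityʳ _) (F.*-identityʳ a))))
      (sym (begin
        a ·ᵛ free C w₀ +ᵛ g +ᵛ free C w            ≡⟨ +ᵛ-assoc (a ·ᵛ free C w₀) g _ ⟩
        a ·ᵛ free C w₀ +ᵛ (g +ᵛ free C w)          ≡⟨ cong (a ·ᵛ free C w₀ +ᵛ_) eq ⟨
        a ·ᵛ free C w₀ +ᵛ (v -ᵛ a ·ᵛ free C w₀)    ≡⟨ +ᵛ-comm (a ·ᵛ free C w₀) _ ⟩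
        v -ᵛ a ·ᵛ free C w₀ +ᵛ a ·ᵛ free C w₀      ≡⟨ -ᵛ+ᵛ v _ ⟩
        v                                          ∎))
    where open ≡-Reasoning

  -- Clears the first column by means of the pivot row 1 ∷ v. Only the inclusion of the old rows in
  -- the new span is recorded, since a code has only to cover them.
  eliminate : ∀ (v : Vect n) (us : Vec (Vect (suc n)) d) →
    Σ[ vs ∈ Vec (Vect n) d ] All (Span ((1# ∷ v) ∷ Vec.map (0# ∷_) vs)) us
  eliminate v []             = [] , []
  eliminate v ((h ∷ t) ∷ us) =
    let vs , ps = eliminate v us
        t′      = t -ᵛ h ·ᵛ v
    in t′ ∷ vs ,
       subst (Span _) (split t′ (-ᵛ+ᵛ t (h ·ᵛ v))) (span-+ (span-· h span-head) (span-tail span-head)) ∷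
       All.map span-insert ps
    where
    split : ∀ t′ → t′ +ᵛ h ·ᵛ v ≡ t → h ·ᵛ (1# ∷ v) +ᵛ (0# ∷ t′) ≡ h ∷ t
    split t′ eq = cong₂ _∷_ (trans (F.+-identityʳ _) (F.*-identityʳ h)) (trans (+ᵛ-comm _ t′) eq)

  -- One column of Gaussian elimination. A pivot uses up one of the d + 1 rows and leaves d for the
  -- remaining columns, as the type of `pivot` requires.
  normalise : ∀ (us : Vec (Vect (suc n)) (suc d)) →
    (∃[ vs ] us ≡ Vec.map (0# ∷_) vs) ⊎
    (∃[ v ] ∃[ vs ] All (Span {d = suc d} ((1# ∷ v) ∷ Vec.map (0# ∷_) vs)) us)
  normalise ((h ∷ t) ∷ us) with h Fin.≟ 0#
  ... | no h≢0 =
    let h⁻¹ , h⁻¹h≡1 = inverse h≢0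
        v            = h⁻¹ ·ᵛ t
        vs , ps      = eliminate v us
    in inj₂ (v , vs , subst (Span _) (rescale h⁻¹h≡1) (span-· h span-head) ∷ ps)
    where
    rescale : ∀ {h⁻¹} → h⁻¹ ⊗ h ≡ 1# → h ·ᵛ (1# ∷ h⁻¹ ·ᵛ t) ≡ h ∷ t
    rescale {h⁻¹} eq = cong₂ _∷_ (F.*-identityʳ h) (·ᵛ-cancel t (trans (F.*-comm h h⁻¹) eq))
  normalise {d = zero}  ((h ∷ t) ∷ []) | yes refl = inj₁ (t ∷ [] , refl)
  normalise {d = suc d} ((h ∷ t) ∷ us) | yes refl with normalise us
  ... | inj₁ (vs , refl)   = inj₁ (t ∷ vs , refl)
  ... | inj₂ (v , vs , ps) = inj₂ (v , t ∷ vs , span-tail span-head ∷ All.map span-insert ps)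

  free-[] : ∀ (C : Code d 0 n) → free C [] ≡ 0ᵛ
  free-[] nil          = refl
  free-[] (pivot C []) = cong (0# ∷_) (free-[] C)

  span-codim-0 : ∀ (C : Code d 0 n) v → Span (rows C) v
  span-codim-0 C v with decompose C v
  ... | g , g∈ , [] , refl = subst (Span (rows C)) (sym (trans (cong (g +ᵛ_) (free-[] C)) (+ᵛ-identityʳ g))) g∈

  -- A subspace containing U meets every graph that U meets, so containment is enough, and dependent
  -- rows can be completed freely.
  cover : ∀ {n} d c → n ≡ d + c → (us : Vec (Vect n) d) → ∃[ C ] All (Span (rows {d} {c} {n} C)) us
  cover {zero}  zero    zero    eq [] = nil , []
  cover {suc n} zero    (suc c) eq [] = skip (proj₁ (cover zero c (suc-injective eq) [])) , []
  cover {suc n} (suc d) c       eq us with normalise us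
  cover {suc n} (suc d) c eq us | inj₂ (v , vs , ps) with cover d c (suc-injective eq) vs
  -- To be in reduced form, the pivot row must vanish at the later pivots; the part `g` that has to
  -- be removed lies in the span of the later rows.
  ... | C , C⊇vs with decompose C v
  ...   | g , g∈ , w , refl = pivot C w ,
    All.map (span-trans (subst (Span _) shift (span-+ span-head (span-tail (span-0∷ g∈))) ∷
                         All.map span-tail (span-map-0∷ C⊇vs))) ps
    where
    shift : (1# ∷ free C w) +ᵛ (0# ∷ g) ≡ 1# ∷ (g +ᵛ free C w)
    shift = cong₂ _∷_ (F.+-identityʳ 1#) (+ᵛ-comm (free C w) g)
  -- Codimension 0 leaves no column to skip, so a zero column gets a pivot all the same. Such a code
  -- spans the whole space, and the rows `replicate d 0ᵛ` are mere filler.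
  cover {suc n} (suc d) zero    eq us | inj₁ _ =
    let C = pivot (proj₁ (cover d 0 (suc-injective eq) (replicate d 0ᵛ))) []
    in C , All.universal (span-codim-0 C) us
  cover {suc n} (suc d) (suc c) eq us | inj₁ (vs , refl) =
    let C , C⊇vs = cover (suc d) c (trans (suc-injective eq) (+-suc d c)) vs
    in skip C , span-map-0∷ C⊇vs

  codes : ∀ d c n → List (Code d c n)
  codesᵖ : ∀ d c n → List (Code d c (suc n))
  codesˢ : ∀ d c n → List (Code d c (suc n))
  codes d       c       (suc n) = codesᵖ d c n List.++ codesˢ d c n
  codes zero    zero    zero    = nil ∷ []
  codes zero    (suc _) zero    = []
  codes (suc _) _       zero    = []
  codesᵖ zero    c n = []
  codesᵖ (suc d) c n = cartesianProductWith pivot (codes d c n) (allVects c)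
  codesˢ d zero    n = []
  codesˢ d (suc c) n = List.map skip (codes d c n)

  ∈-codes : ∀ (C : Code d c n) → C ∈ codes d c n
  ∈-codes nil                 = here refl
  ∈-codes (pivot C w)         = ∈-++⁺ˡ (∈-cartesianProductWith⁺ pivot (∈-codes C) (∈-allVects w))
  ∈-codes {d} (skip {c = c} {n} C) = ∈-++⁺ʳ (codesᵖ d (suc c) n) (∈-map⁺ skip (∈-codes C))

  module _ (0<q : 0 < q) where
    private instance
      q-nonZero : NonZero q
      q-nonZero = >-nonZero 0<q

    -- The pivots form one of at most 2 ^ n sets of coordinates, and each of the d pivot rows has at
    -- most c free entries.
    length-codes : ∀ d c n → length (codes d c n) ≤ 2 ^ n * q ^ (d * c)
    length-codesᵖ : ∀ d c n → length (codesᵖ d c n) ≤ 2 ^ n * q ^ (d * c)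
    length-codesˢ : ∀ d c n → length (codesˢ d c n) ≤ 2 ^ n * q ^ (d * c)
    length-codes zero    zero    zero    = ≤-refl
    length-codes zero    (suc c) zero    = z≤n
    length-codes (suc d) c       zero    = z≤n
    length-codes d       c       (suc n) = begin
      length (codesᵖ d c n List.++ codesˢ d c n)        ≡⟨ List.length-++ (codesᵖ d c n) ⟩
      length (codesᵖ d c n) + length (codesˢ d c n)     ≤⟨ +-mono-≤ (length-codesᵖ d c n) (length-codesˢ d c n) ⟩
      2 ^ n * q ^ (d * c) + 2 ^ n * q ^ (d * c)         ≡⟨ double (2 ^ n) (q ^ (d * c)) ⟩
      2 ^ suc n * q ^ (d * c)                           ∎
      where
      open ≤-Reasoning
      double : ∀ a b → a * b + a * b ≡ 2 * a * b
      double = solve-∀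
    length-codesᵖ zero    c n = z≤n
    length-codesᵖ (suc d) c n = begin
      length (codesᵖ (suc d) c n)               ≡⟨ length-cartesianProductWith pivot (codes d c n) _ ⟩
      length (codes d c n) * length (allVects c) ≤⟨ *-mono-≤ (length-codes d c n) (≤-reflexive (length-allVects c)) ⟩
      2 ^ n * q ^ (d * c) * q ^ c               ≡⟨ *-assoc (2 ^ n) _ _ ⟩
      2 ^ n * (q ^ (d * c) * q ^ c)             ≡⟨ cong (2 ^ n *_) (trans (sym (^-distribˡ-+-* q (d * c) c)) (cong (q ^_) (+-comm (d * c) c))) ⟩
      2 ^ n * q ^ (suc d * c)                   ∎
      where open ≤-Reasoning
    length-codesˢ d zero    n = z≤n
    length-codesˢ d (suc c) n = begin
      length (List.map skip (codes d c n)) ≡⟨ List.length-map skip (codes d c n) ⟩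
      length (codes d c n)                 ≤⟨ length-codes d c n ⟩
      2 ^ n * q ^ (d * c)                  ≤⟨ *-monoʳ-≤ (2 ^ n) (^-monoʳ-≤ q (*-monoʳ-≤ d (n≤1+n c))) ⟩
      2 ^ n * q ^ (d * suc c)              ∎
      where open ≤-Reasoning

-- Graphs of matrices

unique⇒∑≤1 : ∀ {A : Set} (_≟_ : DecidableEquality A) {xs} → Unique xs → ∀ x → ∑ xs (λ y → 𝟙 (y ≟ x)) ≤ 1
unique⇒∑≤1 _≟_ []                    x = z≤n
unique⇒∑≤1 {A} _≟_ (_∷_ {x = y} {xs} y∉xs unique) x with y ≟ x
... | yes refl = s≤s (≤-reflexive (absent y∉xs))
  where
  absent : ∀ {zs : List A} → ListAll.All (y ≢_) zs → ∑ zs (λ z → 𝟙 (z ≟ y)) ≡ 0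
  absent []               = refl
  absent {z ∷ zs} (y≢z ∷ y∉zs) = cong₂ _+_ (𝟙-false (z ≟ y) (y≢z ∘ sym)) (absent y∉zs)
... | no _     = unique⇒∑≤1 _≟_ unique x

vectors-unique : ∀ {A : Set} {xs : List A} → Unique xs → ∀ n → Unique (vectors xs n)
vectors-unique unique zero    = [] ∷ []
vectors-unique unique (suc n) = cartesianProductWith⁺ _∷_ Vec.∷-injective unique (vectors-unique unique n)

module Pool {q : ℕ} (𝔽 : FieldOn q) where
  private
    module F = FieldOn 𝔽
  open F using (0#; 1#; inverse; 1≢0; _⊗_)
  open Vectors 𝔽
  open Codes 𝔽

  private variable
    c d k m n r : ℕ

  1<q : 1 < q
  1<q = go 0# 1# 1≢0
    where
    go : ∀ {q} (a b : Fin q) → b ≢ a → 1 < q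
    go {suc (suc q)} a    b    b≢a = s≤s (s≤s z≤n)
    go {suc zero}    zero zero b≢a = contradiction refl b≢a

  private instance
    q-nonZero : NonZero q
    q-nonZero = >-nonZero (<⇒≤ 1<q)

  -- One vector, with first nonzero entry 1, on every line through the origin.
  points : ∀ d → List (Vect d)
  points zero    = []
  points (suc d) = List.map (1# ∷_) (allVects d) List.++ List.map (0# ∷_) (points d)

  length-points-suc : ∀ d → length (points (suc d)) ≡ q ^ d + length (points d)
  length-points-suc d = trans (List.length-++ (List.map (1# ∷_) (allVects d)))
    (cong₂ _+_ (trans (List.length-map _ (allVects d)) (length-allVects d)) (List.length-map _ (points d)))

  -- The two bounds prove each other: the geometric tail after q ^ d is at most q ^ d again, and 2 ≤
  -- q turns 2q ^ d into q ^ (d+1). This avoids the division in (q ^ d - 1) / (q - 1).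
  length-points : ∀ d → length (points d) ≤ q ^ d
  length-points≤2q^d : ∀ d → length (points (suc d)) ≤ 2 * q ^ d
  length-points zero    = z≤n
  length-points (suc d) = ≤-trans (length-points≤2q^d d) (*-monoˡ-≤ (q ^ d) 1<q)
  length-points≤2q^d d = begin
    length (points (suc d))    ≡⟨ length-points-suc d ⟩
    q ^ d + length (points d)  ≤⟨ +-monoʳ-≤ (q ^ d) (length-points d) ⟩
    q ^ d + q ^ d              ≡⟨ cong (q ^ d +_) (+-identityʳ _) ⟨
    2 * q ^ d                  ∎
    where open ≤-Reasoning

  -- The scalar comes with its inverse, so that the scaling can later be undone.
  ∃-point : ∀ (v : Vect d) → v ≢ 0ᵛ → ∃[ a ] ∃[ b ] b ⊗ a ≡ 1# × a ·ᵛ v ∈ points d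
  ∃-point []      v≢0 = contradiction refl v≢0
  ∃-point (x ∷ v) v≢0 with x Fin.≟ 0#
  ... | no x≢0 =
    let x⁻¹ , x⁻¹x≡1 = inverse x≢0
    in x⁻¹ , x , trans (F.*-comm x x⁻¹) x⁻¹x≡1 ,
       subst (λ y → y ∷ x⁻¹ ·ᵛ v ∈ points _) (sym x⁻¹x≡1) (∈-++⁺ˡ (∈-map⁺ (1# ∷_) (∈-allVects _)))
  ... | yes refl =
    let a , b , ba≡1 , av∈ = ∃-point v (v≢0 ∘ cong (0# ∷_))
    in a , b , ba≡1 ,
       subst (λ y → y ∷ a ·ᵛ v ∈ points _) (sym (F.zeroʳ a)) (∈-++⁺ʳ (List.map (1# ∷_) (allVects _)) (∈-map⁺ (0# ∷_) av∈))

  pool : ∀ k r → List (Vec (Vect r) k)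
  pool k r = vectors (allVects r) k

  length-pool : ∀ k r → length (pool k r) ≡ (q ^ r) ^ k
  length-pool k r = trans (length-vectors (allVects r) k) (cong (_^ k) (length-allVects r))

  graph : Vec (Vect r) k → Vec (Vect (k + r)) k
  graph A = zipWith Vec._++_ (identity _) A

  lin-graph : ∀ (x : Vect k) (A : Vec (Vect r) k) → lin x (graph A) ≡ x Vec.++ lin x A
  lin-graph x A = trans (lin-++ x (identity _) A) (cong (Vec._++ lin x A) (lin-identity x))

  open ≤-Reasoning

  -- At the first nonzero entry of x, the corresponding row of A is determined by the later rows;
  -- rows at zero entries before it are free.
  count-solutions : ∀ (x : Vect k) (y : Vect r) → x ≢ 0ᵛ →
    ∑ (pool k r) (λ A → 𝟙 (lin x A ≟ᵛ y)) * q ^ r ≤ length (pool k r)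
  count-solutions []      y x≢0 = contradiction refl x≢0
  count-solutions {suc k} {r} (a ∷ x) y x≢0 = begin
    ∑ (pool (suc k) r) (λ A → 𝟙 (lin (a ∷ x) A ≟ᵛ y)) * q ^ r
      ≡⟨ cong (_* q ^ r) (∑-cartesianProductWith _ _∷_ (allVects r) (pool k r)) ⟩
    ∑ (allVects r) (λ v → ∑ (pool k r) λ A → 𝟙 (a ·ᵛ v +ᵛ lin x A ≟ᵛ y)) * q ^ r
      ≤⟨ bound ⟩
    length (allVects r) * length (pool k r)
      ≡⟨ length-cartesianProductWith _∷_ (allVects r) (pool k r) ⟨
    length (pool (suc k) r) ∎
    where
    bound : ∑ (allVects r) (λ v → ∑ (pool k r) λ A → 𝟙 (a ·ᵛ v +ᵛ lin x A ≟ᵛ y)) * q ^ r ≤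
            length (allVects r) * length (pool k r)
    bound with a Fin.≟ 0#
    ... | yes refl = begin
      ∑ (allVects r) (λ v → ∑ (pool k r) λ A → 𝟙 (0# ·ᵛ v +ᵛ lin x A ≟ᵛ y)) * q ^ r
        ≤⟨ *-monoˡ-≤ (q ^ r) (∑-mono (allVects r) λ v → ∑-mono (pool k r) λ A →
             𝟙-mono (0# ·ᵛ v +ᵛ lin x A ≟ᵛ y) (lin x A ≟ᵛ y)
               (trans (sym (trans (cong (_+ᵛ lin x A) (·ᵛ-zeroˡ v)) (+ᵛ-identityˡ _))))) ⟩
      ∑ (allVects r) (λ v → ∑ (pool k r) λ A → 𝟙 (lin x A ≟ᵛ y)) * q ^ r
        ≡⟨ cong (_* q ^ r) (∑-const _ (allVects r)) ⟩
      length (allVects r) * ∑ (pool k r) (λ A → 𝟙 (lin x A ≟ᵛ y)) * q ^ r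
        ≡⟨ *-assoc (length (allVects r)) _ _ ⟩
      length (allVects r) * (∑ (pool k r) (λ A → 𝟙 (lin x A ≟ᵛ y)) * q ^ r)
        ≤⟨ *-monoʳ-≤ (length (allVects r)) (count-solutions x y (x≢0 ∘ cong (0# ∷_))) ⟩
      length (allVects r) * length (pool k r) ∎
    ... | no a≢0 = begin
      ∑ (allVects r) (λ v → ∑ (pool k r) λ A → 𝟙 (a ·ᵛ v +ᵛ lin x A ≟ᵛ y)) * q ^ r
        ≡⟨ cong (_* q ^ r) (∑-swap _ (allVects r) (pool k r)) ⟩
      ∑ (pool k r) (λ A → ∑ (allVects r) λ v → 𝟙 (a ·ᵛ v +ᵛ lin x A ≟ᵛ y)) * q ^ r
        ≤⟨ *-monoˡ-≤ (q ^ r) (∑-mono (pool k r) unique-row) ⟩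
      ∑ (pool k r) (λ _ → 1) * q ^ r
        ≡⟨ cong₂ _*_ (trans (∑-const 1 (pool k r)) (*-identityʳ (length (pool k r)))) (sym (length-allVects r)) ⟩
      length (pool k r) * length (allVects r)
        ≡⟨ *-comm (length (pool k r)) _ ⟩
      length (allVects r) * length (pool k r) ∎
      where
      a⁻¹ = proj₁ (inverse a≢0)
      solved : ∀ v w → a ·ᵛ v +ᵛ w ≡ y → v ≡ a⁻¹ ·ᵛ (y -ᵛ w)
      solved v w eq = trans (sym (·ᵛ-cancel v (proj₂ (inverse a≢0))))
        (cong (a⁻¹ ·ᵛ_) (+ᵛ-cancelʳ (a ·ᵛ v) (y -ᵛ w) w (trans eq (sym (-ᵛ+ᵛ y w)))))
      unique-row : ∀ A → ∑ (allVects r) (λ v → 𝟙 (a ·ᵛ v +ᵛ lin x A ≟ᵛ y)) ≤ 1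
      unique-row A = ≤-trans
        (∑-mono (allVects r) λ v → 𝟙-mono (a ·ᵛ v +ᵛ lin x A ≟ᵛ y) (v ≟ᵛ (a⁻¹ ·ᵛ (y -ᵛ lin x A))) (solved v (lin x A)))
        (unique⇒∑≤1 _≟ᵛ_ (vectors-unique (allFin⁺ q) r) (a⁻¹ ·ᵛ (y -ᵛ lin x A)))

  -- The graph of A has no nonzero vector over x = 0, so the first condition says u ≢ 0ᵛ.
  OnGraph : Vect (k + r) → Vec (Vect r) k → Set
  OnGraph {k} u A = take k u ≢ 0ᵛ × lin (take k u) A ≡ drop k u

  onGraph? : ∀ (u : Vect (k + r)) A → Dec (OnGraph u A)
  onGraph? {k} u A = ¬? (take k u ≟ᵛ 0ᵛ) ×-dec (lin (take k u) A ≟ᵛ drop k u)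

  count-onGraph : ∀ (u : Vect (k + r)) → ∑ (pool k r) (λ A → 𝟙 (onGraph? u A)) * q ^ r ≤ length (pool k r)
  count-onGraph {k} {r} u = bound (take k u ≟ᵛ 0ᵛ)
    where
    bound : Dec (take k u ≡ 0ᵛ) → _
    bound (yes x≡0) = subst (λ z → z * q ^ r ≤ length (pool k r))
      (sym (∑-𝟙-false (onGraph? u) (pool k r) λ A p → proj₁ p x≡0)) z≤n
    bound (no x≢0) = ≤-trans
      (*-monoˡ-≤ (q ^ r) (∑-mono (pool k r) λ A → 𝟙-mono (onGraph? u A) (lin (take k u) A ≟ᵛ drop k u) proj₂))
      (count-solutions (take k u) (drop k u) x≢0)

  Hits : Code (suc k) c (k + r) → Vec (Vect r) k → Set
  Hits {k} C A = Any (λ p → OnGraph (lin p (rows C)) A) (points (suc k))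

  hits? : ∀ (C : Code (suc k) c (k + r)) A → Dec (Hits C A)
  hits? {k} C A = any? (λ p → onGraph? (lin p (rows C)) A) (points (suc k))

  Agree : Vec (Vect r) k → Vec (Vect r) k → Vect k → Set
  Agree A B x = x ≢ 0ᵛ × lin x A ≡ lin x B

  agree? : ∀ (A B : Vec (Vect r) k) x → Dec (Agree A B x)
  agree? A B x = ¬? (x ≟ᵛ 0ᵛ) ×-dec (lin x A ≟ᵛ lin x B)

  -- A graph has a single vector over each x, so two graphs share a nonzero vector exactly when
  -- their matrices agree on some x ≢ 0.
  Clash : Vec (Vect r) k → Vec (Vect r) k → Set
  Clash {k = k} A B = Any (Agree A B) (allVects k)

  clash? : ∀ (A B : Vec (Vect r) k) → Dec (Clash A B)
  clash? {k = k} A B = any? (agree? A B) (allVects k)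

  clash-sym : ∀ {A B : Vec (Vect r) k} → Clash A B → Clash B A
  clash-sym = Any.map (λ { {x} (x≢0 , eq) → x≢0 , sym eq })

  union-bound : ∀ {X : Set} (xs : List X) (f : Vec (Vect r) k → X → ℕ) →
    (∀ x → ∑ (pool k r) (λ A → f A x) * q ^ r ≤ length (pool k r)) →
    ∑ (pool k r) (λ A → ∑ xs (f A)) * q ^ r ≤ length xs * length (pool k r)
  union-bound {r} {k} xs f f≤ = begin
    ∑ (pool k r) (λ A → ∑ xs (f A)) * q ^ r      ≡⟨ cong (_* q ^ r) (∑-swap f (pool k r) xs) ⟩
    ∑ xs (λ x → ∑ (pool k r) λ A → f A x) * q ^ r ≡⟨ *-distribʳ-∑ (q ^ r) _ xs ⟨
    ∑ xs (λ x → ∑ (pool k r) (λ A → f A x) * q ^ r) ≤⟨ ∑-mono xs f≤ ⟩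
    ∑ xs (λ _ → length (pool k r))               ≡⟨ ∑-const _ xs ⟩
    length xs * length (pool k r)                ∎

  count-hits : ∀ (C : Code (suc k) c (k + r)) →
    ∑ (pool k r) (λ A → 𝟙 (hits? C A)) * q ^ r ≤ 2 * q ^ k * length (pool k r)
  count-hits {k} {c} {r} C = begin
    ∑ (pool k r) (λ A → 𝟙 (hits? C A)) * q ^ r
      ≤⟨ *-monoˡ-≤ (q ^ r) (∑-mono (pool k r) λ A → 𝟙-any (λ p → onGraph? (lin p (rows C)) A) (points (suc k)) (hits? C A) id) ⟩
    ∑ (pool k r) (λ A → ∑ (points (suc k)) λ p → 𝟙 (onGraph? (lin p (rows C)) A)) * q ^ r
      ≤⟨ union-bound {r} {k} (points (suc k)) (λ A p → 𝟙 (onGraph? (lin p (rows C)) A)) (λ p → count-onGraph {k} {r} (lin p (rows C))) ⟩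
    length (points (suc k)) * length (pool k r)
      ≤⟨ *-monoˡ-≤ (length (pool k r)) (length-points≤2q^d k) ⟩
    2 * q ^ k * length (pool k r) ∎

  count-clashes : ∀ (B : Vec (Vect r) k) →
    ∑ (pool k r) (λ A → 𝟙 (clash? A B)) * q ^ r ≤ q ^ k * length (pool k r)
  count-clashes {r} {k} B = begin
    ∑ (pool k r) (λ A → 𝟙 (clash? A B)) * q ^ r
      ≤⟨ *-monoˡ-≤ (q ^ r) (∑-mono (pool k r) λ A → 𝟙-any (agree? A B) (allVects k) (clash? A B) id) ⟩
    ∑ (pool k r) (λ A → ∑ (allVects k) λ x → 𝟙 (agree? A B x)) * q ^ r
      ≤⟨ union-bound {r} {k} (allVects k) (λ A x → 𝟙 (agree? A B x)) (λ x → bound x (x ≟ᵛ 0ᵛ)) ⟩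
    length (allVects k) * length (pool k r)
      ≡⟨ cong (_* length (pool k r)) (length-allVects k) ⟩
    q ^ k * length (pool k r) ∎
    where
    bound : ∀ x → Dec (x ≡ 0ᵛ) → ∑ (pool k r) (λ A → 𝟙 (agree? A B x)) * q ^ r ≤ length (pool k r)
    bound x (yes x≡0) = subst (λ z → z * q ^ r ≤ length (pool k r))
      (sym (∑-𝟙-false (λ A → agree? A B x) (pool k r) λ A p → proj₁ p x≡0)) z≤n
    bound x (no x≢0) = ≤-trans
      (*-monoˡ-≤ (q ^ r) (∑-mono (pool k r) λ A → 𝟙-mono (agree? A B x) (lin x A ≟ᵛ lin x B) proj₂))
      (count-solutions x (lin x B) x≢0)

  module _ {k h c : ℕ} where
    private
      N = length (pool k (k + h))

    -- A single test succeeds with probability at most q ^ -(k+h), and the number of tests is q ^ k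
    -- up to a constant; what remains is the q ^ h used for `H`.
    cancel-q^k : ∀ a b → a * q ^ (k + h) ≤ b * q ^ k * N → a * q ^ h ≤ b * N
    cancel-q^k a b le = *-cancelˡ-≤ (q ^ k) {{m^n≢0 q k}} (begin
      q ^ k * (a * q ^ h) ≡⟨ e₁ (q ^ k) a (q ^ h) ⟩
      a * (q ^ k * q ^ h) ≡⟨ cong (a *_) (^-distribˡ-+-* q k h) ⟨
      a * q ^ (k + h)     ≤⟨ le ⟩
      b * q ^ k * N       ≡⟨ e₂ b (q ^ k) N ⟩
      q ^ k * (b * N)     ∎)
      where
      e₁ : ∀ a b c → a * (b * c) ≡ b * (a * c)
      e₁ = solve-∀
      e₂ : ∀ a b c → a * b * c ≡ b * (a * c)
      e₂ = solve-∀

    hits-bound : ∀ C → ∑ (pool k (k + h)) (λ A → 𝟙 (hits? {c = c} C A)) * q ^ h ≤ 2 * N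
    hits-bound C = cancel-q^k (∑ (pool k (k + h)) (λ A → 𝟙 (hits? C A))) 2 (count-hits C)

    clash-bound : ∀ B → ∑ (pool k (k + h)) (λ A → 𝟙 (clash? A B)) * q ^ h ≤ N
    clash-bound B = subst (clashes * q ^ h ≤_) (+-identityʳ N)
      (cancel-q^k clashes 1 (subst (λ z → clashes * q ^ (k + h) ≤ z * N) (sym (+-identityʳ (q ^ k))) (count-clashes B)))
      where clashes = ∑ (pool k (k + h)) (λ A → 𝟙 (clash? A B))

    0<N : 0 < N
    0<N = subst (0 <_) (sym (length-pool k (k + h))) (m^n>0 (q ^ (k + h)) {{m^n≢0 q (k + h)}} k)

    open Greedy (pool k (k + h)) (codes (suc k) c (k + (k + h))) hits? clash? clash-sym

    ∃-clashless : ∀ L M x → 0 < M → 0 < x → 8 * (x * M) ≤ q ^ h →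
      2 * length (codes (suc k) c (k + (k + h))) < x ^ suc L →
      Σ[ As ∈ Vec (Vec (Vect (k + h)) k) M ]
        (∀ {i j} → i ≢ j → ¬ Clash (lookup As i) (lookup As j)) ×
        (∀ (C : Code (suc k) c (k + (k + h))) → count (hits? C) As ≤ L)
    ∃-clashless L M x 0<M 0<x 8xM≤ big =
      let As , clashless , sparse = ∃-sparse (q ^ h) x hits-bound clash-bound 0<N 0<M 0<x 8xM≤ big
      in As , clashless , λ C → sparse (∈-codes C)

-- Almost sparse families of row spaces

∃? : ∀ {xs : List A} → (∀ x → x ∈ xs) → {P : Pred A ℓ} → Decidable P → Dec (∃[ x ] P x)
∃? {xs = xs} complete P? = map′ Any.satisfied (λ (x , Px) → lose (complete x) Px) (any? P? xs)

∀? : ∀ {xs : List A} → (∀ x → x ∈ xs) → {P : Pred A ℓ} → Decidable P → Dec (∀ x → P x)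
∀? {xs = xs} complete P? =
  map′ (λ all x → ListAll.lookup all (complete x)) (λ P → ListAll.universal P xs) (ListAll.all? P? xs)

-- The definition of sparseness bounds sets of indices known to be met, the matrix version a
-- decidable count. This lemma passes from the second to the first, `count-as-subset` back.
∣S∣≤count : ∀ {P : Pred A ℓ} (P? : Decidable P) {m} (S : Subset m) (xs : Vec A m) →
  (∀ {i} → i Subset.∈ S → P (lookup xs i)) → Subset.∣ S ∣ ≤ count P? xs
∣S∣≤count P? []      []       S⊆P = z≤n
∣S∣≤count P? (outside ∷ S) (x ∷ xs) S⊆P with ∣S∣≤count P? S xs (S⊆P ∘ Vec.there) | P? x
... | ih | yes _ = m≤n⇒m≤1+n ih
... | ih | no _  = ih
∣S∣≤count P? (inside ∷ S) (x ∷ xs) S⊆P with ∣S∣≤count P? S xs (S⊆P ∘ Vec.there) | P? x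
... | ih | yes _ = s≤s ih
... | ih | no ¬p = contradiction (S⊆P Vec.here) ¬p

count-as-subset : ∀ {P : Pred A ℓ} (P? : Decidable P) {m} (xs : Vec A m) →
  Σ[ S ∈ Subset m ] (∀ {i} → i Subset.∈ S → P (lookup xs i)) × count P? xs ≤ Subset.∣ S ∣
count-as-subset P? []       = [] , (λ { {()} }) , z≤n
count-as-subset {P = P} P? (x ∷ xs) with P? x | count-as-subset P? xs
... | yes px | S , S⊆P , le = inside ∷ S , (λ { Vec.here → px ; (Vec.there i∈) → S⊆P i∈ }) , s≤s le
... | no _   | S , S⊆P , le = outside ∷ S , (λ { (Vec.there i∈) → S⊆P i∈ }) , le

count-map-mono : ∀ {P : Pred A ℓ} {Q : Pred B ℓ′} (P? : Decidable P) (Q? : Decidable Q) (f : B → A) →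
  (∀ {x} → P (f x) → Q x) → ∀ {m} (xs : Vec B m) → count P? (Vec.map f xs) ≤ count Q? xs
count-map-mono P? Q? f P⇒Q []       = z≤n
count-map-mono P? Q? f P⇒Q (x ∷ xs) with P? (f x) | Q? x | count-map-mono P? Q? f P⇒Q xs
... | yes _ | yes _ | ih = s≤s ih
... | yes p | no ¬q | ih = contradiction (P⇒Q p) ¬q
... | no _  | yes _ | ih = m≤n⇒m≤1+n ih
... | no _  | no _  | ih = ih

bounded-maximum : ∀ {P : Pred ℕ ℓ} → Decidable P → ∀ N → (∀ {m} → P m → m ≤ N) → ∀ {m₀} → P m₀ →
  ∃[ m ] (P m × (∀ {m′} → P m′ → m′ ≤ m)) × m₀ ≤ m
bounded-maximum P? zero    bound {m₀} Pm₀ = m₀ , (Pm₀ , λ Pm → ≤-trans (bound Pm) z≤n) , ≤-refl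
bounded-maximum P? (suc N) bound {m₀} Pm₀ with P? (suc N)
... | yes P = suc N , (P , bound) , bound Pm₀
... | no ¬P = bounded-maximum P? N (λ Pm → s≤s⁻¹ (≤∧≢⇒< (bound Pm) λ { refl → ¬P Pm })) Pm₀

injective⇒≤length : ∀ {xs : List A} → (∀ x → x ∈ xs) → ∀ {m} (f : Fin m → A) → (∀ {i j} → f i ≡ f j → i ≡ j) →
  m ≤ length xs
injective⇒≤length {xs = xs} complete f f-injective = Fin.injective⇒≤ λ {i} {j} eq →
  f-injective (trans (Any.lookup-index (complete (f i)))
    (trans (cong (List.lookup xs) eq) (sym (Any.lookup-index (complete (f j))))))

module Sparse {q : ℕ} (𝔽 : FieldOn q) where
  open FieldOn 𝔽 using (0#; 1≢0)
  open Vectors 𝔽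
  open Codes 𝔽
  open Pool 𝔽

  private variable
    d e k m n : ℕ

  Independent : Vec (Vect n) d → Set
  Independent us = ∀ c → lin c us ≡ 0ᵛ → c ≡ 0ᵛ

  independent? : ∀ (us : Vec (Vect n) d) → Dec (Independent us)
  independent? us = ∀? ∈-allVects λ c → (lin c us ≟ᵛ 0ᵛ) →-dec (c ≟ᵛ 0ᵛ)

  span? : ∀ (us : Vec (Vect n) d) v → Dec (Span us v)
  span? us v = ∃? ∈-allVects λ b → v ≟ᵛ lin b us

  Meet : Vec (Vect n) d → Vec (Vect n) e → Set
  Meet us vs = ∃[ v ] v ≢ 0ᵛ × Span us v × Span vs v

  meet? : ∀ (us : Vec (Vect n) d) (vs : Vec (Vect n) e) → Dec (Meet us vs)
  meet? us vs = ∃? ∈-allVects λ v → ¬? (v ≟ᵛ 0ᵛ) ×-dec (span? us v ×-dec span? vs v)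

  -- The family is given by bases and U by a basis, so that every quantifier ranges over a finite
  -- type and the whole condition is decidable.
  AlmostSparse : ℕ → Vec (Vec (Vect n) k) m → Set
  AlmostSparse {n} {k} L Bs =
    (∀ i → Independent (lookup Bs i)) ×
    (∀ i j → i ≢ j → ¬ Meet (lookup Bs i) (lookup Bs j)) ×
    (∀ (us : Vec (Vect n) (suc k)) → Independent us → count (meet? us) Bs ≤ L)

  almostSparse? : ∀ L (Bs : Vec (Vec (Vect n) k) m) → Dec (AlmostSparse L Bs)
  almostSparse? {n} {k} L Bs =
    Fin.all? (λ i → independent? (lookup Bs i)) ×-dec
    (Fin.all? (λ i → Fin.all? λ j → ¬? (i Fin.≟ j) →-dec ¬? (meet? (lookup Bs i) (lookup Bs j))) ×-dec
    ∀? (∈-vectors ∈-allVects) (λ us → independent? us →-dec (count (meet? us) Bs ≤? L)))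

  ∃almostSparse? : ∀ n k L m → Dec (Σ[ Bs ∈ Vec (Vec (Vect n) k) m ] AlmostSparse L Bs)
  ∃almostSparse? n k L m = ∃? (∈-vectors (∈-vectors ∈-allVects)) (almostSparse? L)

  row≢0 : ∀ {us : Vec (Vect n) d} → Independent us → ∀ i → lookup us i ≢ 0ᵛ
  row≢0 {us = us} ind i row≡0 = unit≢0 i (ind (unit i) (trans (lin-unit us i) row≡0))
    where
    unit≢0 : ∀ {d} (i : Fin d) → unit i ≢ 0ᵛ
    unit≢0 zero    eq = 1≢0 (Vec.∷-injectiveˡ eq)
    unit≢0 (suc i) eq = unit≢0 i (Vec.∷-injectiveʳ (trans (sym (Vec.lookup-map i (0# ∷_) (identity _))) eq))

  span-row : ∀ (us : Vec (Vect n) d) i → Span us (lookup us i)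
  span-row us i = unit i , sym (lin-unit us i)

  -- A nonzero row common to two bases would be a common vector, so the first rows are distinct. The
  -- bound serves only to make the search for the maximum finite.
  size-bound : ∀ {L} {Bs : Vec (Vec (Vect n) (suc k)) m} → AlmostSparse L Bs → m ≤ q ^ n
  size-bound {n} {Bs = Bs} (ind , disjoint , _) = subst (_ ≤_) (length-allVects n)
    (injective⇒≤length ∈-allVects row₀ row₀-injective)
    where
    row₀ : Fin _ → Vect n
    row₀ i = lookup (lookup Bs i) zero
    row₀-injective : ∀ {i j} → row₀ i ≡ row₀ j → i ≡ j
    row₀-injective {i} {j} eq with i Fin.≟ j
    ... | yes i≡j = i≡j
    ... | no  i≢j = contradiction
      (row₀ i , row≢0 (ind i) zero , span-row (lookup Bs i) zero , subst (Span (lookup Bs j)) (sym eq) (span-row (lookup Bs j) zero))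
      (disjoint i j i≢j)

  graph-independent : ∀ {r} (A : Vec (Vect r) k) → Independent (graph A)
  graph-independent {k} A x eq = Vec.++-injectiveˡ x 0ᵛ (trans (sym (lin-graph x A)) (trans eq (sym (0ᵛ-++ {k}))))

  x≢0 : ∀ {r} {A : Vec (Vect r) k} {x} → x Vec.++ lin x A ≢ 0ᵛ → x ≢ 0ᵛ
  x≢0 {k} {A = A} v≢0 refl = v≢0 (trans (cong (0ᵛ Vec.++_) (lin-0 A)) (0ᵛ-++ {k}))

  meet⇒clash : ∀ {r} (A B : Vec (Vect r) k) → Meet (graph A) (graph B) → Clash A B
  meet⇒clash A B (v , v≢0 , (x , refl) , (y , eq)) =
    lose (∈-allVects x) (x≢0 {A = A} (v≢0 ∘ trans (lin-graph x A)) ,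
      trans (Vec.++-injectiveʳ x y eq′) (cong (λ z → lin z B) (sym (Vec.++-injectiveˡ x y eq′))))
    where
    eq′ : x Vec.++ lin x A ≡ y Vec.++ lin y B
    eq′ = trans (sym (lin-graph x A)) (trans eq (lin-graph y B))

  -- The common vector is a combination b of the rows of C. Scaling b to the chosen representative
  -- of its line keeps the vector on the graph, which is linear, and keeps it nonzero, as the scalar
  -- is invertible.
  meet⇒hits : ∀ {r c} (C : Code (suc k) c (k + r)) {us : Vec (Vect (k + r)) (suc k)} → All (Span (rows C)) us →
    ∀ (A : Vec (Vect r) k) → Meet us (graph A) → Hits C A
  meet⇒hits {k} C C⊇us A (v , v≢0 , v∈us , (x , refl)) with span-trans C⊇us v∈us
  ... | b , eq with ∃-point b (λ { refl → v≢0 (trans eq (lin-0 (rows C))) })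
  ...   | a , a′ , a′a≡1 , ab∈ = lose ab∈ (subst (λ u → OnGraph u A) (sym lin-ab) (ax≢0 , trans (cong (λ z → lin z A) take-ax) (sym drop-ax)))
    where
    u = (a ·ᵛ x) Vec.++ lin (a ·ᵛ x) A
    lin-ab : lin (a ·ᵛ b) (rows C) ≡ u
    lin-ab = trans (lin-· a b (rows C)) (trans (cong (a ·ᵛ_) (sym eq))
      (trans (sym (lin-· a x (graph A))) (lin-graph (a ·ᵛ x) A)))
    take-ax : take k u ≡ a ·ᵛ x
    take-ax = Vec.++-injectiveˡ (take k u) (a ·ᵛ x) (Vec.take++drop≡id k u)
    drop-ax : drop k u ≡ lin (a ·ᵛ x) A
    drop-ax = Vec.++-injectiveʳ (take k u) (a ·ᵛ x) (Vec.take++drop≡id k u)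
    ax≢0 : take k u ≢ 0ᵛ
    ax≢0 eq′ = x≢0 {A = A} (v≢0 ∘ trans (lin-graph x A)) (trans (sym (·ᵛ-cancel x a′a≡1))
      (trans (cong (a′ ·ᵛ_) (trans (sym take-ax) eq′)) (·ᵛ-zeroʳ a′)))

  -- Here `c` is n - (k+1), the codimension of the subspaces U, and the last hypothesis bounds twice
  -- the number of codes.
  ∃-graph-family : ∀ k h c L M x → k + h ≡ suc c → 0 < M → 0 < x → 8 * (x * M) ≤ q ^ h →
    2 * (2 ^ (k + (k + h)) * q ^ (suc k * c)) < x ^ suc L →
    Σ[ Bs ∈ Vec (Vec (Vect (k + (k + h))) k) M ] AlmostSparse L Bs
  ∃-graph-family k h c L M x k+h≡1+c 0<M 0<x 8xM≤ big =
    let As , clashless , sparse = ∃-clashless {k} {h} {c} L M x 0<M 0<x 8xM≤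
          (≤-<-trans (*-monoʳ-≤ 2 (length-codes (<⇒≤ 1<q) (suc k) c (k + (k + h)))) big)
    in Vec.map graph As ,
       (λ i → subst Independent (sym (Vec.lookup-map i graph As)) (graph-independent (lookup As i))) ,
       (λ i j i≢j meet → clashless i≢j (meet⇒clash (lookup As i) (lookup As j)
          (subst₂ Meet (Vec.lookup-map i graph As) (Vec.lookup-map j graph As) meet))) ,
       λ us _ →
         let C , C⊇us = cover (suc k) c (trans (cong (k +_) k+h≡1+c) (+-suc k c)) us
         in ≤-trans (count-map-mono (meet? us) (hits? C) graph (λ {A} → meet⇒hits C C⊇us A) As) (sparse C)

  -- Covers the case of a target size below 1, where one subspace is enough.
  ∃-singleton-family : ∀ k r L → 0 < L → Σ[ Bs ∈ Vec (Vec (Vect (k + r)) k) 1 ] AlmostSparse L Bs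
  ∃-singleton-family k r L 0<L = graph (replicate k 0ᵛ) ∷ [] ,
    (λ { zero → graph-independent (replicate k 0ᵛ) }) ,
    (λ { zero zero 0≢0 → contradiction refl 0≢0 }) ,
    λ us _ → ≤-trans (Vec.count≤n (meet? us) (graph (replicate k 0ᵛ) ∷ [])) 0<L

-- Passage between abstract subspaces and matrices of coordinates

module Coordinates {q : ℕ} (K : FiniteField q) where
  open Transport K
  private
    module K = FiniteField K
  open Vectors fieldOn
  open Codes fieldOn
  open Pool fieldOn
  open Sparse fieldOn

  private variable
    d k m n : ℕ

  coords : (Fin d → K.Carrier) → Vect d
  coords v = tabulate (to ∘ v)

  vector : Vect d → Fin d → K.Carrier
  vector c = from ∘ lookup c

  coords-cong : ∀ {u v : Fin d → K.Carrier} → (∀ i → u i K.≈ v i) → coords u ≡ coords v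
  coords-cong u≈v = Vec.tabulate-cong (to-cong ∘ u≈v)

  coords-injective : ∀ {u v : Fin d → K.Carrier} → coords u ≡ coords v → ∀ i → u i K.≈ v i
  coords-injective {u = u} {v} eq i = to-injective
    (trans (sym (Vec.lookup∘tabulate (to ∘ u) i)) (trans (cong (λ c → lookup c i) eq) (Vec.lookup∘tabulate (to ∘ v) i)))

  coords-vector : ∀ (c : Vect d) → coords (vector c) ≡ c
  coords-vector c = trans (Vec.tabulate-cong (to∘from ∘ lookup c)) (Vec.tabulate∘lookup c)

  module _ {n : ℕ} where
    module L = LinearAlgebra K n

  coords-0 : ∀ n → coords (L.0ᵛ {n}) ≡ 0ᵛ
  coords-0 zero    = refl
  coords-0 (suc n) = cong (_ ∷_) (coords-0 n)

  coords-+ : ∀ {n} (u v : L.V {n}) → coords (u L.+ᵛ v) ≡ coords u +ᵛ coords v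
  coords-+ {zero}  u v = refl
  coords-+ {suc n} u v = cong₂ _∷_ (to-+ (u zero) (v zero)) (coords-+ (u ∘ suc) (v ∘ suc))

  coords-· : ∀ {n} a (v : L.V {n}) → coords (a L.·ᵛ v) ≡ to a ·ᵛ coords v
  coords-· {zero}  a v = refl
  coords-· {suc n} a v = cong₂ _∷_ (to-* a (v zero)) (coords-· a (v ∘ suc))

  coords-combination : ∀ (c : Fin d → K.Carrier) (v : Fin d → L.V {n}) →
    coords (L.combination c v) ≡ lin (coords c) (tabulate (coords ∘ v))
  coords-combination {zero}  {n} c v = coords-0 n
  coords-combination {suc d} c v =
    trans (coords-+ (c zero L.·ᵛ v zero) (L.combination (c ∘ suc) (v ∘ suc)))
      (cong₂ _+ᵛ_ (coords-· (c zero) (v zero)) (coords-combination (c ∘ suc) (v ∘ suc)))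

  ≋0⇒coords≡0 : ∀ {v : L.V {n}} → L._≋_ {n} v L.0ᵛ → coords v ≡ 0ᵛ
  ≋0⇒coords≡0 {n} v≋0 = trans (coords-cong v≋0) (coords-0 n)

  coords≡0⇒≋0 : ∀ {v : L.V {n}} → coords v ≡ 0ᵛ → L._≋_ {n} v L.0ᵛ
  coords≡0⇒≋0 {n} eq = coords-injective (trans eq (sym (coords-0 n)))

  spanSubspace : Vec (Vect n) d → L.Subspace {n}
  spanSubspace {n} us = record
    { member   = Span us ∘ coords
    ; resp-≋   = λ u≋v → subst (Span us) (coords-cong u≋v)
    ; 0-closed = subst (Span us) (sym (coords-0 n)) span-0
    ; +-closed = λ {u} {v} u∈ v∈ → subst (Span us) (sym (coords-+ u v)) (span-+ u∈ v∈)
    ; ·-closed = λ a {v} v∈ → subst (Span us) (sym (coords-· a v)) (span-· (to a) v∈)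
    }

  coords-combination-rows : ∀ (us : Vec (Vect n) d) (c : Fin d → K.Carrier) →
    coords (L.combination c (vector ∘ lookup us)) ≡ lin (coords c) us
  coords-combination-rows us c = trans (coords-combination c (vector ∘ lookup us))
    (cong (lin (coords c)) (trans (Vec.tabulate-cong (coords-vector ∘ lookup us)) (Vec.tabulate∘lookup us)))

  span-hasDimension : ∀ {us : Vec (Vect n) d} → Independent us → L.HasDimension (spanSubspace us) d
  span-hasDimension {us = us} ind = record
    { basis       = vector ∘ lookup us
    ; basis∈W     = λ i → subst (Span us) (sym (coords-vector (lookup us i))) (span-row us i)
    ; independent = λ c eq → coords≡0⇒≋0 (ind (coords c) (trans (sym (coords-combination-rows us c)) (≋0⇒coords≡0 eq)))
    ; spanning    = λ (b , eq) → vector b , coords-injective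
        (trans eq (sym (trans (coords-combination-rows us (vector b)) (cong (λ c → lin c us) (coords-vector b)))))
    }

  module Rows {n d : ℕ} {W : L.Subspace {n}} (dim : L.HasDimension W d) where
    open L.HasDimension dim

    basisRows : Vec (Vect n) d
    basisRows = tabulate (coords ∘ basis)

    basisRows-independent : Independent basisRows
    basisRows-independent c eq = trans (sym (coords-vector c)) (≋0⇒coords≡0 (independent (vector c)
      (coords≡0⇒≋0 (trans (coords-combination (vector c) basis) (trans (cong (λ c → lin c basisRows) (coords-vector c)) eq)))))

    member⇒span : ∀ {v} → L.member W v → Span basisRows (coords v)
    member⇒span v∈ = let c , eq = spanning v∈ in coords c , trans (coords-cong eq) (coords-combination c basis)

    span⇒member : ∀ {v} → Span basisRows (coords v) → L.member W v
    span⇒member (b , eq) = L.resp-≋ W (coords-injective (trans (coords-combination (vector b) basis)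
        (trans (cong (λ c → lin c basisRows) (coords-vector b)) (sym eq)))) (combination∈ (vector b) basis basis∈W)
      where
      combination∈ : ∀ {d} (c : Fin d → K.Carrier) (v : Fin d → L.V) → (∀ i → L.member W (v i)) → L.member W (L.combination c v)
      combination∈ {zero}  c v v∈ = L.0-closed W
      combination∈ {suc d} c v v∈ = L.+-closed W (L.·-closed W (c zero) (v∈ zero)) (combination∈ (c ∘ suc) (v ∘ suc) (v∈ ∘ suc))

  almostSparse⇒family : ∀ {L} (Bs : Vec (Vec (Vect n) (suc k)) m) → AlmostSparse L Bs → HasASFamily K n (suc k) L m
  almostSparse⇒family {n} {k} {m} {L} Bs (ind , disjoint , sparse) = F , record
    { partialSpread = record
      { dimension = λ i → span-hasDimension (ind i)
      ; distinct  = distinct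
      ; disjoint  = λ {i} {j} → trivial {i} {j}
      }
    ; sparse = λ U dimU S S-meets → let open Rows dimU in
        ≤-trans (∣S∣≤count (meet? basisRows) S Bs λ {i} i∈S →
            let v , v∈U , v∈F , v≉0 = S-meets i∈S
            in coords v , v≉0 ∘ coords≡0⇒≋0 , member⇒span v∈U , v∈F)
          (sparse basisRows basisRows-independent)
    }
    where
    F : Fin m → L.Subspace {n}
    F i = spanSubspace (lookup Bs i)
    trivial : ∀ {i j} → i ≢ j → L.TrivialIntersection (F i) (F j)
    trivial {i} {j} i≢j {v} v∈i v∈j with coords v ≟ᵛ 0ᵛ
    ... | yes v≡0 = coords≡0⇒≋0 v≡0
    ... | no  v≢0 = contradiction (coords v , v≢0 , v∈i , v∈j) (disjoint i j i≢j)
    -- Equal members would share the first row of a basis; it exists because the dimension is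
    -- `suc k`, and it is nonzero by independence.
    distinct : ∀ {i j} → (∀ {v} → Span (lookup Bs i) (coords v) → Span (lookup Bs j) (coords v)) ×
                         (∀ {v} → Span (lookup Bs j) (coords v) → Span (lookup Bs i) (coords v)) → i ≡ j
    distinct {i} {j} (i⊆j , _) with i Fin.≟ j
    ... | yes i≡j = i≡j
    ... | no  i≢j = contradiction
      (row , row≢0 (ind i) zero , span-row (lookup Bs i) zero ,
       subst (Span (lookup Bs j)) (coords-vector row)
         (i⊆j {vector row} (subst (Span (lookup Bs i)) (sym (coords-vector row)) (span-row (lookup Bs i) zero))))
      (disjoint i j i≢j)
      where row = lookup (lookup Bs i) zero

  family⇒almostSparse : ∀ {L} → HasASFamily K n k L m → Σ[ Bs ∈ Vec (Vec (Vect n) k) m ] AlmostSparse L Bs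
  family⇒almostSparse {n} {k} {m} {L} (F , as) = Bs ,
    (λ i → subst Independent (sym (lookup-Bs i)) (basisRows-independent (dimension i))) ,
    (λ i j i≢j (c , c≢0 , c∈i , c∈j) → c≢0 (trans (sym (coords-vector c))
      (≋0⇒coords≡0 (disjoint i≢j (member-F i c∈i) (member-F j c∈j))))) ,
    λ us ind → let S , S⊆ , le = count-as-subset (meet? us) Bs in
      ≤-trans le (sparse (spanSubspace us) (span-hasDimension ind) S λ {i} i∈S →
        let c , c≢0 , c∈us , c∈Bs = S⊆ i∈S
        in vector c , subst (Span us) (sym (coords-vector c)) c∈us , member-F i c∈Bs ,
           λ c≋0 → c≢0 (trans (sym (coords-vector c)) (≋0⇒coords≡0 c≋0)))
    where
    open L.IsAlmostSparse as
    open L.IsPartialSpread partialSpread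
    open Rows
    Bs : Vec (Vec (Vect n) k) m
    Bs = tabulate λ i → basisRows (dimension i)
    lookup-Bs : ∀ i → lookup Bs i ≡ basisRows (dimension i)
    lookup-Bs = Vec.lookup∘tabulate λ i → basisRows (dimension i)
    member-F : ∀ i {c} → Span (lookup Bs i) c → L.member (F i) (vector c)
    member-F i {c} c∈ = span⇒member (dimension i)
      (subst₂ Span (lookup-Bs i) (sym (coords-vector c)) c∈)

  hasASFamily? : ∀ n k L m → Dec (HasASFamily K n (suc k) L m)
  hasASFamily? n k L m = map′ (λ (Bs , as) → almostSparse⇒family Bs as) family⇒almostSparse (∃almostSparse? n (suc k) L m)

  ∃-maximum : ∀ {n k L m₀} → HasASFamily K n (suc k) L m₀ → ∃[ m ] IsMaximum (HasASFamily K n (suc k) L) m × m₀ ≤ m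
  ∃-maximum {n} {k} {L} = bounded-maximum (hasASFamily? n k L) (q ^ n) λ F →
    let Bs , as = family⇒almostSparse F in size-bound {Bs = Bs} as

-- The choice of parameters

crossing : ∀ (f : ℕ → ℕ) N b → f 0 ≤ b → b < f N → ∃[ m ] f m ≤ b × b < f (suc m)
crossing f zero    b f0≤b b<f0 = contradiction f0≤b (<⇒≱ b<f0)
crossing f (suc N) b f0≤b b<fN with f N ≤? b
... | yes fN≤b = N , fN≤b , b<fN
... | no  fN≰b = crossing f N b f0≤b (≰⇒> fN≰b)

-- The integer part of the (s+1)-st root of b / a, found by a discrete crossing argument between 0
-- and b + 1.
root : ∀ s a b → 0 < a → ∃[ m ] m ^ suc s * a ≤ b × b < suc m ^ suc s * a
root s a b 0<a = crossing (λ m → m ^ suc s * a) (suc b) b z≤n (begin-strict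
  b                 <⟨ n<1+n b ⟩
  suc b             ≡⟨ *-identityʳ (suc b) ⟨
  suc b * 1         ≤⟨ *-monoʳ-≤ (suc b) (m^n>0 (suc b) s) ⟩
  suc b ^ suc s     ≡⟨ *-identityʳ (suc b ^ suc s) ⟨
  suc b ^ suc s * 1 ≤⟨ *-monoʳ-≤ (suc b ^ suc s) 0<a ⟩
  suc b ^ suc s * a ∎)
  where open ≤-Reasoning

^-distribʳ-* : ∀ s a b → (a * b) ^ s ≡ a ^ s * b ^ s
^-distribʳ-* zero    a b = refl
^-distribʳ-* (suc s) a b = trans (cong (a * b *_) (^-distribʳ-* s a b)) (interchange a b (a ^ s) (b ^ s))
  where
  interchange : ∀ a b c d → a * b * (c * d) ≡ a * c * (b * d)
  interchange = solve-∀

suc≤2* : ∀ m → 0 < m → suc m ≤ 2 * m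
suc≤2* m 0<m = +-mono-≤ 0<m (≤-reflexive (sym (+-identityʳ m)))

module _ (q : ℕ) (1<q : 1 < q) (k c : ℕ) where
  private instance
    q-nonZero : NonZero q
    q-nonZero = >-nonZero (<⇒≤ 1<q)

  -- The exponent (c + 1)(k + 1) exceeds (k + 1)c by k + 1, which leaves a factor of q
  -- to absorb every constant.
  room : q * q ^ (suc k * c) ≤ q ^ (suc c * suc k)
  room = begin
    q * q ^ (suc k * c)     ≡⟨⟩
    q ^ suc (suc k * c)     ≤⟨ ^-monoʳ-≤ q (s≤s (m≤n+m (suc k * c) k)) ⟩
    q ^ (suc k + suc k * c) ≡⟨ cong (q ^_) (cong (suc k +_) (*-comm (suc k) c)) ⟩
    q ^ (suc c * suc k)     ∎
    where open ≤-Reasoning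

  -- Here x = y + 1 and M = m + 1 for integer parts y, m ≥ 1, so rounding up at most doubles each: 8
  -- becomes 32. In (s+1)-st powers, the resulting 32 ^ (s+1) and the 2 · 2 ^ n from the number of
  -- codes are paid for by the spare factor q of `room`.
  8xM≤H : ∀ s n H y m → 32 ^ suc s * (2 * 2 ^ n) ≤ q → 0 < H → 0 < y → 0 < m →
    m ^ suc s * q ^ (suc c * suc k) ≤ H ^ suc s →
    y ^ suc s ≤ 2 * (2 ^ n * q ^ (suc k * c)) →
    8 * (suc y * suc m) ≤ H
  8xM≤H s n H y m large 0<H 0<y 0<m m^s≤ y^s≤ = ≮⇒≥ λ H<8xM → <⇒≱ (begin-strict
    H ^ suc s * Z
      <⟨ *-monoˡ-< Z {{m^n≢0 q (suc c * suc k)}} (^-monoˡ-< (suc s) (<-≤-trans H<8xM 8xM≤32ym)) ⟩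
    (32 * (y * m)) ^ suc s * Z
      ≡⟨ cong (_* Z) (trans (^-distribʳ-* (suc s) 32 (y * m)) (cong (32 ^ suc s *_) (^-distribʳ-* (suc s) y m))) ⟩
    32 ^ suc s * (y ^ suc s * m ^ suc s) * Z
      ≡⟨ e₁ (32 ^ suc s) (y ^ suc s) (m ^ suc s) Z ⟩
    32 ^ suc s * (y ^ suc s * (m ^ suc s * Z))
      ≤⟨ *-monoʳ-≤ (32 ^ suc s) (*-mono-≤ y^s≤ m^s≤) ⟩
    32 ^ suc s * (2 * (2 ^ n * T) * H ^ suc s)
      ≡⟨ e₂ (32 ^ suc s) (2 ^ n) T (H ^ suc s) ⟩
    H ^ suc s * (32 ^ suc s * (2 * 2 ^ n) * T)
      ∎) (*-monoʳ-≤ (H ^ suc s) (≤-trans (*-monoˡ-≤ T large) room))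
    where
    open ≤-Reasoning
    Z = q ^ (suc c * suc k)
    T = q ^ (suc k * c)
    8xM≤32ym : 8 * (suc y * suc m) ≤ 32 * (y * m)
    8xM≤32ym = begin
      8 * (suc y * suc m)     ≤⟨ *-monoʳ-≤ 8 (*-mono-≤ (suc≤2* y 0<y) (suc≤2* m 0<m)) ⟩
      8 * (2 * y * (2 * m))   ≡⟨ e₃ y m ⟩
      32 * (y * m)            ∎
      where
      e₃ : ∀ y m → 8 * (2 * y * (2 * m)) ≡ 32 * (y * m)
      e₃ = solve-∀
    e₁ : ∀ a b c d → a * (b * c) * d ≡ a * (b * (c * d))
    e₁ = solve-∀
    e₂ : ∀ a b c d → a * (2 * (b * c) * d) ≡ d * (a * (2 * b) * c)
    e₂ = solve-∀

threshold : ℕ → ℕ → ℕ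
threshold n L = 32 ^ suc L * (2 * 2 ^ n)

module _ {q : ℕ} (K : FiniteField q) where
  open Transport K using (fieldOn)
  open Pool fieldOn using (1<q)
  open Sparse fieldOn
  open Coordinates K

  private instance
    q-nonZero : NonZero q
    q-nonZero = >-nonZero (<⇒≤ 1<q)

  -- The inequality is m ≥ q ^ (h - r(k+1)/(L+1)), with r the number of columns, raised to the power
  -- L + 1 and freed of negative exponents.
  large-family : ∀ k h L → 0 < L → let n = suc k + (suc k + h) in threshold n L ≤ q →
    ∃[ m ] HasASFamily K n (suc k) L m × (q ^ h) ^ suc L ≤ m ^ suc L * q ^ ((suc k + h) * suc (suc k))
  large-family k h L 0<L large = choose (root L Z ((q ^ h) ^ suc L) (m^n>0 q e)) (root L 1 T (s≤s z≤n))
    where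
    n = suc k + (suc k + h)
    e = (suc k + h) * suc (suc k)
    Z = q ^ e
    T = 2 * (2 ^ n * q ^ (suc (suc k) * (k + h)))

    1≤T : 1 ≤ T
    1≤T = *-mono-≤ {1} {2} (s≤s z≤n) (*-mono-≤ (m^n>0 2 n) (m^n>0 q (suc (suc k) * (k + h))))

    family : ∀ {M} → Σ[ Bs ∈ _ ] AlmostSparse L Bs → HasASFamily K n (suc k) L M
    family (Bs , as) = almostSparse⇒family Bs as

    choose : (∃[ m ] m ^ suc L * Z ≤ (q ^ h) ^ suc L × (q ^ h) ^ suc L < suc m ^ suc L * Z) →
      (∃[ y ] y ^ suc L * 1 ≤ T × T < suc y ^ suc L * 1) →
      ∃[ m ] HasASFamily K n (suc k) L m × (q ^ h) ^ suc L ≤ m ^ suc L * Z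
    -- Integer part 0: the target is below 1.
    choose (zero  , _  , H<M) _ = 1 , family (∃-singleton-family (suc k) (suc k + h) L 0<L) , <⇒≤ H<M
    choose (suc m , _  , _) (zero , _ , T<1) =
      contradiction (subst (T <_) (trans (*-identityʳ (1 ^ suc L)) (^-zeroˡ (suc L))) T<1) (≤⇒≯ 1≤T)
    -- M and x are the integer parts plus one: M then exceeds the target, and x ^ (L+1) exceeds `T`.
    choose (suc m , m≤ , H<M) (suc y , y≤ , T<x) = suc (suc m) ,
      family (∃-graph-family (suc k) h (k + h) L (suc (suc m)) (suc (suc y)) refl (s≤s z≤n) (s≤s z≤n)
        (8xM≤H q 1<q (suc k) (k + h) L n (q ^ h) (suc y) (suc m) large (m^n>0 q h) (s≤s z≤n) (s≤s z≤n) m≤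
          (subst (_≤ T) (*-identityʳ (suc y ^ suc L)) y≤))
        (subst (T <_) (*-identityʳ (suc (suc y) ^ suc L)) T<x)) ,
      <⇒≤ H<M

-- Prime fields

-- Not imported above, where it would make the sections (n +_) ambiguous.
open import Data.Integer.Base using (+_)

-- Euclid's argument: a prime factor of N! + 1 that is at most N would divide 1.
∃-prime : ∀ N → ∃[ p ] N < p × Prime p
∃-prime N with factorise (suc (N !))
... | record { factors = [] ; isFactorisation = eq } =
  contradiction eq (λ 1+N!≡1 → <⇒≢ (1≤n! N) (sym (suc-injective 1+N!≡1)))
... | record { factors = p ∷ ps ; isFactorisation = eq ; factorsPrime = isPrime ∷ _ } =
  p , ≰⇒> p≰N , isPrime
  where
  instance
    p-nonZero : NonZero p
    p-nonZero = prime⇒nonZero isPrime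
  p∣1+N! : p ∣ N ! + 1
  p∣1+N! = subst (p ∣_) (trans (sym eq) (+-comm 1 (N !))) (m∣m*n (product ps))
  p≰N : ¬ p ≤ N
  p≰N p≤N = contradiction
    (∣1⇒≡1 (∣m+n∣m⇒∣n p∣1+N! (∣-trans (p∣p! p) (m≤n⇒m!∣n! p≤N))))
    (nonTrivial⇒≢1 {{prime⇒nonTrivial isPrime}})
    where
    p∣p! : ∀ p .{{_ : NonZero p}} → p ∣ p !
    p∣p! (suc p) = m∣m*n (p !)

module PrimeField {p : ℕ} (isPrime : Prime p) where
  private instance
    p-nonZero : NonZero p
    p-nonZero = prime⇒nonZero isPrime

  infix 4 _≈_
  infixr 4 _⨾_
  -- Congruence modulo p with the quotient as witness. With ℤ under this relation as the carrier,
  -- the ring laws are those of ℤ, and `Fin p` enters only through the enumeration.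
  record _≈_ (x y : ℤ) : Set where
    constructor _⨾_
    field
      multiple : ℤ
      equality : x ≡ y ℤ.+ multiple ℤ.* + p

  ≡⇒≈ : ∀ {x y} → x ≡ y → x ≈ y
  ≡⇒≈ {x} refl = 0ℤ ⨾ lemma x (+ p)
    where
    lemma : ∀ x p → x ≡ x ℤ.+ 0ℤ ℤ.* p
    lemma = ℤ.solve-∀

  ≈-sym : ∀ {x y} → x ≈ y → y ≈ x
  ≈-sym {_} {y} (c ⨾ eq) = ℤ.- c ⨾ trans (lemma y c (+ p)) (cong (ℤ._+ ℤ.- c ℤ.* + p) (sym eq))
    where
    lemma : ∀ y c p → y ≡ y ℤ.+ c ℤ.* p ℤ.+ ℤ.- c ℤ.* p
    lemma = ℤ.solve-∀

  ≈-trans : ∀ {x y z} → x ≈ y → y ≈ z → x ≈ z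
  ≈-trans {_} {_} {z} (c ⨾ refl) (d ⨾ refl) = c ℤ.+ d ⨾ lemma z c d (+ p)
    where
    lemma : ∀ z c d p → z ℤ.+ d ℤ.* p ℤ.+ c ℤ.* p ≡ z ℤ.+ (c ℤ.+ d) ℤ.* p
    lemma = ℤ.solve-∀

  +-cong : ∀ {x y u v} → x ≈ y → u ≈ v → x ℤ.+ u ≈ y ℤ.+ v
  +-cong {_} {y} {_} {v} (c ⨾ refl) (d ⨾ refl) = c ℤ.+ d ⨾ lemma y v c d (+ p)
    where
    lemma : ∀ y v c d p → y ℤ.+ c ℤ.* p ℤ.+ (v ℤ.+ d ℤ.* p) ≡ y ℤ.+ v ℤ.+ (c ℤ.+ d) ℤ.* p
    lemma = ℤ.solve-∀

  *-cong : ∀ {x y u v} → x ≈ y → u ≈ v → x ℤ.* u ≈ y ℤ.* v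
  *-cong {_} {y} {_} {v} (c ⨾ refl) (d ⨾ refl) = c ℤ.* v ℤ.+ y ℤ.* d ℤ.+ c ℤ.* d ℤ.* + p ⨾ lemma y v c d (+ p)
    where
    lemma : ∀ y v c d p → (y ℤ.+ c ℤ.* p) ℤ.* (v ℤ.+ d ℤ.* p) ≡
      y ℤ.* v ℤ.+ (c ℤ.* v ℤ.+ y ℤ.* d ℤ.+ c ℤ.* d ℤ.* p) ℤ.* p
    lemma = ℤ.solve-∀

  neg-cong : ∀ {x y} → x ≈ y → ℤ.- x ≈ ℤ.- y
  neg-cong {_} {y} (c ⨾ refl) = ℤ.- c ⨾ lemma y c (+ p)
    where
    lemma : ∀ y c p → ℤ.- (y ℤ.+ c ℤ.* p) ≡ ℤ.- y ℤ.+ ℤ.- c ℤ.* p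
    lemma = ℤ.solve-∀

  residue : ℤ → ℕ
  residue z = z %ℕ p

  ≈-residue : ∀ z → z ≈ + residue z
  ≈-residue z = z /ℕ p ⨾ a≡a%ℕn+[a/ℕn]*n z p

  no-wrap : ∀ {a b} → a < p → ∀ c → + a ≢ + b ℤ.+ + suc c ℤ.* + p
  no-wrap {a} {b} a<p c eq = <⇒≱ a<p (subst (p ≤_) (sym (ℤ.+-injective
    (trans eq (cong (ℤ._+_ (+ b)) (sym (ℤ.pos-* (suc c) p)))))) (≤-trans (m≤m+n p (c * p)) (m≤n+m _ b)))

  residues-unique : ∀ {a b} → a < p → b < p → + a ≈ + b → a ≡ b
  residues-unique {a} {b} a<p b<p (+ zero ⨾ eq) = ℤ.+-injective (trans eq (ℤ.+-identityʳ (+ b)))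
  residues-unique {a} {b} a<p b<p (+ suc c ⨾ eq) = contradiction eq (no-wrap a<p c)
  residues-unique {a} {b} a<p b<p (-[1+ c ] ⨾ eq) =
    contradiction (_≈_.equality (≈-sym (-[1+ c ] ⨾ eq))) (no-wrap b<p c)

  residue-≈ : ∀ {x y} → residue x ≡ residue y → x ≈ y
  residue-≈ {x} {y} eq = ≈-trans (≈-residue x) (≈-trans (≡⇒≈ (cong +_ eq)) (≈-sym (≈-residue y)))

  _≈?_ : ∀ x y → Dec (x ≈ y)
  x ≈? y with residue x ≟ residue y
  ... | yes eq = yes (residue-≈ eq)
  ... | no neq = no λ x≈y → neq (residues-unique (n%ℕd<d x p) (n%ℕd<d y p)
    (≈-trans (≈-sym (≈-residue x)) (≈-trans x≈y (≈-residue y))))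

  1<p : 1 < p
  1<p = nonTrivial⇒n>1 p {{prime⇒nonTrivial isPrime}}

  0≉1 : ¬ (0ℤ ≈ 1ℤ)
  0≉1 0≈1 with () ← residues-unique {0} {1} (<-trans (s≤s z≤n) 1<p) 1<p 0≈1

  -- A nonzero residue below p is coprime to p, so Bézout's identity supplies the inverse, with a
  -- sign that depends on its form.
  inverse : ∀ z → ¬ (z ≈ 0ℤ) → ∃[ b ] b ℤ.* z ≈ 1ℤ
  inverse z z≉0 = let b , br≈1 = go (residue z) (n%ℕd<d z p) λ r≡0 → z≉0 (≈-trans (≈-residue z) (≡⇒≈ (cong +_ r≡0)))
                  in b , ≈-trans (*-cong {b} (≡⇒≈ refl) (≈-residue z)) br≈1
    where
    go : ∀ r → r < p → r ≢ 0 → ∃[ b ] b ℤ.* + r ≈ 1ℤ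
    go r r<p r≢0 with coprime-Bézout (prime⇒coprime isPrime {{≢-nonZero r≢0}} r<p)
    ... | Bézout.+- x y eq = ℤ.- + y , (ℤ.- + x ⨾ (begin
      ℤ.- + y ℤ.* + r                                  ≡⟨ e₁ (+ y) (+ r) ⟩
      1ℤ ℤ.+ ℤ.- (1ℤ ℤ.+ + y ℤ.* + r)                  ≡⟨ cong (λ w → 1ℤ ℤ.+ ℤ.- w) eqℤ ⟩
      1ℤ ℤ.+ ℤ.- (+ x ℤ.* + p)                         ≡⟨ e₂ (+ x) (+ p) ⟩
      1ℤ ℤ.+ ℤ.- + x ℤ.* + p                           ∎))
      where
      open ≡-Reasoning
      eqℤ : 1ℤ ℤ.+ + y ℤ.* + r ≡ + x ℤ.* + p
      eqℤ = trans (cong (ℤ._+_ 1ℤ) (sym (ℤ.pos-* y r))) (trans (cong +_ eq) (ℤ.pos-* x p))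
      e₁ : ∀ y r → ℤ.- y ℤ.* r ≡ 1ℤ ℤ.+ ℤ.- (1ℤ ℤ.+ y ℤ.* r)
      e₁ = ℤ.solve-∀
      e₂ : ∀ x p → 1ℤ ℤ.+ ℤ.- (x ℤ.* p) ≡ 1ℤ ℤ.+ ℤ.- x ℤ.* p
      e₂ = ℤ.solve-∀
    ... | Bézout.-+ x y eq = + y ,
      (+ x ⨾ trans (sym (ℤ.pos-* y r)) (trans (cong +_ (sym eq)) (cong (ℤ._+_ 1ℤ) (ℤ.pos-* x p))))

  to : ℤ → Fin p
  to z = fromℕ< (n%ℕd<d z p)

  from : Fin p → ℤ
  from i = + toℕ i

  to-unique : ∀ {z i} → z ≈ from i → to z ≡ i
  to-unique {z} {i} z≈i = Fin.toℕ-injective (trans (Fin.toℕ-fromℕ< _)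
    (residues-unique (n%ℕd<d z p) (Fin.toℕ<n i) (≈-trans (≈-sym (≈-residue z)) z≈i)))

  from∘to : ∀ z → from (to z) ≈ z
  from∘to z = ≈-trans (≡⇒≈ (cong +_ (Fin.toℕ-fromℕ< _))) (≈-sym (≈-residue z))

  difference≈0⇒≈ : ∀ {x y} → x ℤ.- y ≈ 0ℤ → x ≈ y
  difference≈0⇒≈ {x} {y} x-y≈0 = ≈-trans (≡⇒≈ (e x y)) (≈-trans (+-cong x-y≈0 (≡⇒≈ {y} refl)) (≡⇒≈ (ℤ.+-identityˡ y)))
    where
    e : ∀ x y → x ≡ x ℤ.- y ℤ.+ y
    e = ℤ.solve-∀

  -- Apartness is the negation of congruence; cotransitivity and tightness then follow from `_≈?_`.
  finiteField : FiniteField p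
  finiteField = record
    { heytingField = record
      { Carrier = ℤ
      ; _≈_ = _≈_
      ; _#_ = λ x y → ¬ (x ≈ y)
      ; _+_ = ℤ._+_
      ; _*_ = ℤ._*_
      ; -_ = ℤ.-_
      ; 0# = 0ℤ
      ; 1# = 1ℤ
      ; isHeytingField = record
        { isHeytingCommutativeRing = record
          { isCommutativeRing = record
            { isRing = record
              { +-isAbelianGroup = record
                { isGroup = record
                  { isMonoid = record
                    { isSemigroup = record
                      { isMagma = record
                        { isEquivalence = record { refl = ≡⇒≈ refl ; sym = ≈-sym ; trans = ≈-trans }
                        ; ∙-cong = +-cong
                        }
                      ; assoc = λ x y z → ≡⇒≈ (ℤ.+-assoc x y z)
                      }
                    ; identity = (λ x → ≡⇒≈ (ℤ.+-identityˡ x)) , (λ x → ≡⇒≈ (ℤ.+-identityʳ x))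
                    }
                  ; inverse = (λ x → ≡⇒≈ (ℤ.+-inverseˡ x)) , (λ x → ≡⇒≈ (ℤ.+-inverseʳ x))
                  ; ⁻¹-cong = neg-cong
                  }
                ; comm = λ x y → ≡⇒≈ (ℤ.+-comm x y)
                }
              ; *-cong = *-cong
              ; *-assoc = λ x y z → ≡⇒≈ (ℤ.*-assoc x y z)
              ; *-identity = (λ x → ≡⇒≈ (ℤ.*-identityˡ x)) , (λ x → ≡⇒≈ (ℤ.*-identityʳ x))
              ; distrib = (λ x y z → ≡⇒≈ (ℤ.*-distribˡ-+ x y z)) , (λ x y z → ≡⇒≈ (ℤ.*-distribʳ-+ x y z))
              }
            ; *-comm = λ x y → ≡⇒≈ (ℤ.*-comm x y)
            }
          ; isApartnessRelation = record
            { irrefl  = λ x≈y x≉y → x≉y x≈y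
            ; sym     = λ x≉y → x≉y ∘ ≈-sym
            ; cotrans = cotrans
            }
          ; #⇒invertible = #⇒invertible
          ; invertible⇒# = λ {x} {y} (b , bz≈1 , _) x≈y → 0≉1 (≈-trans (≈-sym (difference b x≈y)) bz≈1)
          }
        ; tight = λ x y → stable x y , λ x≈y x≉y → x≉y x≈y
        }
      }
    ; enumeration = record
      { to = to
      ; from = from
      ; to-cong = λ {x} {y} x≈y → to-unique (≈-trans x≈y (≈-sym (from∘to y)))
      ; from-cong = λ { refl → ≡⇒≈ refl }
      ; inverse = to-unique , λ { {x} refl → from∘to x }
      }
    }
    where
    cotrans : ∀ {x y} → ¬ (x ≈ y) → ∀ z → ¬ (x ≈ z) ⊎ ¬ (z ≈ y)
    cotrans {x} x≉y z with x ≈? z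
    ... | yes x≈z = inj₂ λ z≈y → x≉y (≈-trans x≈z z≈y)
    ... | no  x≉z = inj₁ x≉z
    stable : ∀ x y → ¬ ¬ (x ≈ y) → x ≈ y
    stable x y ¬¬x≈y with x ≈? y
    ... | yes x≈y = x≈y
    ... | no  x≉y = contradiction x≉y ¬¬x≈y
    #⇒invertible : ∀ {x y} → ¬ (x ≈ y) → Invertible _≈_ 1ℤ ℤ._*_ (x ℤ.- y)
    #⇒invertible {x} {y} x≉y =
      let b , bz≈1 = inverse (x ℤ.- y) (x≉y ∘ difference≈0⇒≈)
      in b , bz≈1 , ≈-trans (≡⇒≈ (ℤ.*-comm (x ℤ.- y) b)) bz≈1
    difference : ∀ {x y} b → x ≈ y → b ℤ.* (x ℤ.- y) ≈ 0ℤ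
    difference {_} {y} b (c ⨾ refl) = b ℤ.* c ⨾ e b y c (+ p)
      where
      e : ∀ b y c p → b ℤ.* (y ℤ.+ c ℤ.* p ℤ.- y) ≡ 0ℤ ℤ.+ b ℤ.* c ℤ.* p
      e = ℤ.solve-∀

-- Rational exponents

-- `_/_` reduces to lowest terms, so numerators and denominators are accessible only up to
-- equivalence of unnormalised fractions.
toℚᵘ-/ : ∀ i d → toℚᵘ (i / suc d) ℚᵘ.≃ mkℚᵘ i d
toℚᵘ-/ i d = ℚ.toℚᵘ-fromℚᵘ (mkℚᵘ i d)

/-mono-≤ : ∀ a b c d .{{_ : NonZero c}} .{{_ : NonZero d}} → a * d ≤ b * c → (+ a) / c ℚ.≤ (+ b) / d
/-mono-≤ a b (suc c) (suc d) le = ℚ.toℚᵘ-cancel-≤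
  (ℚᵘ.≤-respˡ-≃ (ℚᵘ.≃-sym (toℚᵘ-/ (+ a) c)) (ℚᵘ.≤-respʳ-≃ (ℚᵘ.≃-sym (toℚᵘ-/ (+ b) d))
    (*≤* (subst₂ ℤ._≤_ (ℤ.pos-* a (suc d)) (ℤ.pos-* b (suc c)) (ℤ.+≤+ le)))))

/-mono-< : ∀ a b c d .{{_ : NonZero c}} .{{_ : NonZero d}} → a * d < b * c → (+ a) / c ℚ.< (+ b) / d
/-mono-< a b (suc c) (suc d) lt = ℚ.toℚᵘ-cancel-<
  (ℚᵘ.<-respˡ-≃ (ℚᵘ.≃-sym (toℚᵘ-/ (+ a) c)) (ℚᵘ.<-respʳ-≃ (ℚᵘ.≃-sym (toℚᵘ-/ (+ b) d))
    (*<* (subst₂ ℤ._<_ (ℤ.pos-* a (suc d)) (ℤ.pos-* b (suc c)) (ℤ.+<+ lt)))))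

/1-homo-* : ∀ a b → (+ (a * b)) / 1 ≡ (+ a) / 1 ℚ.* ((+ b) / 1)
/1-homo-* a b = ℚ.toℚᵘ-injective (begin-equality
  toℚᵘ ((+ (a * b)) / 1)                     ≃⟨ toℚᵘ-/ (+ (a * b)) 0 ⟩
  mkℚᵘ (+ (a * b)) 0                         ≡⟨ cong (λ z → mkℚᵘ z 0) (ℤ.pos-* a b) ⟩
  mkℚᵘ (+ a) 0 ℚᵘ.* mkℚᵘ (+ b) 0             ≃⟨ ℚᵘ.*-cong (toℚᵘ-/ (+ a) 0) (toℚᵘ-/ (+ b) 0) ⟨
  toℚᵘ ((+ a) / 1) ℚᵘ.* toℚᵘ ((+ b) / 1)     ≃⟨ ℚ.toℚᵘ-homo-* ((+ a) / 1) ((+ b) / 1) ⟨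
  toℚᵘ ((+ a) / 1 ℚ.* ((+ b) / 1))           ∎)
  where open ℚᵘ.≤-Reasoning

/1-homo-^ : ∀ a b → (+ (a ^ b)) / 1 ≡ ((+ a) / 1) ^ℚ b
/1-homo-^ a zero    = refl
/1-homo-^ a (suc b) = trans (/1-homo-* a (a ^ b)) (cong ((+ a) / 1 ℚ.*_) (/1-homo-^ a b))

^ℚ-nonNeg : ∀ {x} b → 0ℚ ℚ.≤ x → 0ℚ ℚ.≤ x ^ℚ b
^ℚ-nonNeg     zero    0≤x = ℚ.nonNegative⁻¹ 1ℚ
^ℚ-nonNeg {x} (suc b) 0≤x = ℚ.nonNegative⁻¹ (x ℚ.* x ^ℚ b)
  {{ℚ.nonNeg*nonNeg⇒nonNeg x {{ℚ.nonNegative 0≤x}} (x ^ℚ b) {{ℚ.nonNegative (^ℚ-nonNeg b 0≤x)}}}}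

^ℚ-mono-≤ : ∀ {x y} b → 0ℚ ℚ.≤ x → x ℚ.≤ y → x ^ℚ b ℚ.≤ y ^ℚ b
^ℚ-mono-≤         zero    0≤x x≤y = ℚ.≤-refl
^ℚ-mono-≤ {x} {y} (suc b) 0≤x x≤y = ℚ.≤-trans
  (ℚ.*-monoˡ-≤-nonNeg x {{ℚ.nonNegative 0≤x}} (^ℚ-mono-≤ b 0≤x x≤y))
  (ℚ.*-monoʳ-≤-nonNeg (y ^ℚ b) {{ℚ.nonNegative (^ℚ-nonNeg b (ℚ.≤-trans 0≤x x≤y))}} x≤y)

-- With the negative part moved across, a comparison with q ^ z becomes one between natural numbers.
posPart negPart : ℤ → ℕ
posPart (+ n)    = n
posPart -[1+ n ] = 0
negPart (+ n)    = 0
negPart -[1+ n ] = suc n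

posPart-negPart : ∀ z → z ≡ + posPart z ℤ.- + negPart z
posPart-negPart (+ n)    = sym (ℤ.+-identityʳ (+ n))
posPart-negPart -[1+ n ] = refl

^ℤ-≤ : ∀ q z B → order q ^ posPart z ≤ B * order q ^ negPart z → q ^ℤ z ℚ.≤ (+ B) / 1
^ℤ-≤ q (+ n)    B le = /-mono-≤ (order q ^ n) B 1 1 (subst (_≤ B * 1) (sym (*-identityʳ (order q ^ n))) le)
^ℤ-≤ q -[1+ n ] B le = /-mono-≤ 1 B (order q ^ suc n) 1 {{m^n≢0 (order q) (suc n) {{order≢0 q}}}} le

^ℤ-< : ∀ q z B → order q ^ posPart z < B * order q ^ negPart z → q ^ℤ z ℚ.< (+ B) / 1
^ℤ-< q (+ n)    B lt = /-mono-< (order q ^ n) B 1 1 (subst (_< B * 1) (sym (*-identityʳ (order q ^ n))) lt)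
^ℤ-< q -[1+ n ] B lt = /-mono-< 1 B (order q ^ suc n) 1 {{m^n≢0 (order q) (suc n) {{order≢0 q}}}} lt

module _ (Q m s P R : ℕ) .{{_ : NonZero Q}} (root≤ : Q ^ P ≤ m ^ suc s * Q ^ R) (b A⁺ A⁻ : ℕ) where

  open ≤-Reasoning

  private
    -- The hypothesis says m ≥ Q ^ ((P - R) / (s+1)). Its b-th power is multiplied by a power of Q,
    -- so that the exponent (A⁺ - A⁻) / b can be compared within the natural numbers.
    upper : Q ^ (P * b + A⁻ * suc s) ≤ (m ^ b * Q ^ A⁻) ^ suc s * Q ^ (R * b)
    upper = begin
      Q ^ (P * b + A⁻ * suc s)                      ≡⟨ ^-distribˡ-+-* Q (P * b) _ ⟩
      Q ^ (P * b) * Q ^ (A⁻ * suc s)                ≡⟨ cong₂ _*_ (^-*-assoc Q P b) (^-*-assoc Q A⁻ (suc s)) ⟨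
      (Q ^ P) ^ b * (Q ^ A⁻) ^ suc s                ≤⟨ *-monoˡ-≤ ((Q ^ A⁻) ^ suc s) (^-monoˡ-≤ b root≤) ⟩
      (m ^ suc s * Q ^ R) ^ b * (Q ^ A⁻) ^ suc s    ≡⟨ cong (_* (Q ^ A⁻) ^ suc s) (^-distribʳ-* b (m ^ suc s) (Q ^ R)) ⟩
      (m ^ suc s) ^ b * (Q ^ R) ^ b * (Q ^ A⁻) ^ suc s ≡⟨ cong₂ (λ x y → x * y * (Q ^ A⁻) ^ suc s) m-powers (^-*-assoc Q R b) ⟩
      (m ^ b) ^ suc s * Q ^ (R * b) * (Q ^ A⁻) ^ suc s ≡⟨ e ((m ^ b) ^ suc s) (Q ^ (R * b)) ((Q ^ A⁻) ^ suc s) ⟩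
      (m ^ b) ^ suc s * (Q ^ A⁻) ^ suc s * Q ^ (R * b) ≡⟨ cong (_* Q ^ (R * b)) (^-distribʳ-* (suc s) (m ^ b) (Q ^ A⁻)) ⟨
      (m ^ b * Q ^ A⁻) ^ suc s * Q ^ (R * b)        ∎
      where
      m-powers : (m ^ suc s) ^ b ≡ (m ^ b) ^ suc s
      m-powers = trans (^-*-assoc m (suc s) b) (trans (cong (m ^_) (*-comm (suc s) b)) (sym (^-*-assoc m b (suc s))))
      e : ∀ a b c → a * b * c ≡ a * c * b
      e = solve-∀

    lower : Q ^ (A⁺ * suc s + R * b) ≡ (Q ^ A⁺) ^ suc s * Q ^ (R * b)
    lower = trans (^-distribˡ-+-* Q (A⁺ * suc s) _) (cong (_* Q ^ (R * b)) (sym (^-*-assoc Q A⁺ (suc s))))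

  -- Instead of taking a root, the negated conclusion is raised to the power s + 1, where it
  -- contradicts `upper`.
  power-≤ : A⁺ * suc s + R * b ≡ P * b + A⁻ * suc s → Q ^ A⁺ ≤ m ^ b * Q ^ A⁻
  power-≤ eq = ≮⇒≥ λ lt → <-irrefl refl (begin-strict
    Q ^ (A⁺ * suc s + R * b)               ≡⟨ cong (Q ^_) eq ⟩
    Q ^ (P * b + A⁻ * suc s)               ≤⟨ upper ⟩
    (m ^ b * Q ^ A⁻) ^ suc s * Q ^ (R * b) <⟨ *-monoˡ-< (Q ^ (R * b)) {{m^n≢0 Q (R * b)}} (^-monoˡ-< (suc s) lt) ⟩
    (Q ^ A⁺) ^ suc s * Q ^ (R * b)         ≡⟨ lower ⟨
    Q ^ (A⁺ * suc s + R * b)               ∎)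

  power-< : 1 < Q → A⁺ * suc s + R * b < P * b + A⁻ * suc s → Q ^ A⁺ < m ^ b * Q ^ A⁻
  power-< 1<Q lt = ≰⇒> λ le → <-irrefl refl (begin-strict
    Q ^ (A⁺ * suc s + R * b)               <⟨ ^-monoʳ-< Q 1<Q lt ⟩
    Q ^ (P * b + A⁻ * suc s)               ≤⟨ upper ⟩
    (m ^ b * Q ^ A⁻) ^ suc s * Q ^ (R * b) ≤⟨ *-monoˡ-≤ (Q ^ (R * b)) (^-monoˡ-≤ (suc s) le) ⟩
    (Q ^ A⁺) ^ suc s * Q ^ (R * b)         ≡⟨ lower ⟨
    Q ^ (A⁺ * suc s + R * b)               ∎)

module _ (a⁺ a⁻ s P R b : ℕ) where

  private
    left : (+ a⁺ ℤ.- + a⁻) ℤ.* + s ℤ.+ (+ a⁻ ℤ.* + s ℤ.+ + R ℤ.* + b) ≡ + (a⁺ * s + R * b)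
    left = trans (e (+ a⁺) (+ a⁻) (+ s) (+ R ℤ.* + b)) (sym (trans (ℤ.pos-+ (a⁺ * s) _) (cong₂ ℤ._+_ (ℤ.pos-* a⁺ s) (ℤ.pos-* R b))))
      where
      e : ∀ a⁺ a⁻ s z → (a⁺ ℤ.- a⁻) ℤ.* s ℤ.+ (a⁻ ℤ.* s ℤ.+ z) ≡ a⁺ ℤ.* s ℤ.+ z
      e = ℤ.solve-∀
    right : (+ P ℤ.- + R) ℤ.* + b ℤ.+ (+ a⁻ ℤ.* + s ℤ.+ + R ℤ.* + b) ≡ + (P * b + a⁻ * s)
    right = trans (e (+ P) (+ R) (+ b) (+ a⁻ ℤ.* + s)) (sym (trans (ℤ.pos-+ (P * b) _) (cong₂ ℤ._+_ (ℤ.pos-* P b) (ℤ.pos-* a⁻ s))))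
      where
      e : ∀ P R b z → (P ℤ.- R) ℤ.* b ℤ.+ (z ℤ.+ R ℤ.* b) ≡ P ℤ.* b ℤ.+ z
      e = ℤ.solve-∀

  -- Adding a⁻ s + R b to both sides removes every subtraction.
  clear-≡ : (+ a⁺ ℤ.- + a⁻) ℤ.* + s ≡ (+ P ℤ.- + R) ℤ.* + b → a⁺ * s + R * b ≡ P * b + a⁻ * s
  clear-≡ eq = ℤ.+-injective (trans (sym left) (trans (cong (ℤ._+ _) eq) right))

  clear-< : (+ a⁺ ℤ.- + a⁻) ℤ.* + s ℤ.< (+ P ℤ.- + R) ℤ.* + b → a⁺ * s + R * b < P * b + a⁻ * s
  clear-< lt = ℤ.drop‿+<+ (subst₂ ℤ._<_ left right (ℤ.+-monoˡ-< (+ a⁻ ℤ.* + s ℤ.+ + R ℤ.* + b) lt))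

-- The exponent as a rational number

rate : ℕ → ℕ → ℕ → ℚ
rate k n L = ((+ n ℤ.- + (2 * k)) / 1) ℚ.- (((+ n ℤ.- + k) ℤ.* + suc k) / suc L)

-- For n = 2k + h the exponent has denominator L + 1 and numerator P - R, with exactly the P and R
-- that occur in the integer bound on m.
rate-≃ : ∀ k h L → toℚᵘ (rate k (k + (k + h)) L) ℚᵘ.≃ mkℚᵘ (+ (h * suc L) ℤ.- + ((k + h) * suc k)) L
rate-≃ k h L = begin-equality
  toℚᵘ (rate k n L)
    ≃⟨ ℚ.toℚᵘ-homo-+ ((+ n ℤ.- + (2 * k)) / 1) (ℚ.- (((+ n ℤ.- + k) ℤ.* + suc k) / suc L)) ⟩
  toℚᵘ ((+ n ℤ.- + (2 * k)) / 1) ℚᵘ.+ toℚᵘ (ℚ.- (((+ n ℤ.- + k) ℤ.* + suc k) / suc L))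
    ≃⟨ ℚᵘ.+-cong (toℚᵘ-/ (+ n ℤ.- + (2 * k)) 0) (ℚᵘ.≃-trans (ℚ.toℚᵘ-homo‿- (((+ n ℤ.- + k) ℤ.* + suc k) / suc L)) (ℚᵘ.-‿cong (toℚᵘ-/ ((+ n ℤ.- + k) ℤ.* + suc k) L))) ⟩
  mkℚᵘ (+ n ℤ.- + (2 * k)) 0 ℚᵘ.+ ℚᵘ.- mkℚᵘ ((+ n ℤ.- + k) ℤ.* + suc k) L
    ≡⟨ cong₂ (λ x y → mkℚᵘ x 0 ℚᵘ.+ ℚᵘ.- mkℚᵘ (y ℤ.* + suc k) L) n-2k≡h n-k≡k+h ⟩
  mkℚᵘ (+ h) 0 ℚᵘ.+ ℚᵘ.- mkℚᵘ (+ (k + h) ℤ.* + suc k) L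
    ≃⟨ *≡* (trans (cong (λ z → (+ h ℤ.* + suc L ℤ.+ ℤ.- z ℤ.* + 1) ℤ.* + suc L) (sym (ℤ.pos-* (k + h) (suc k))))
         (trans (cong (λ z → (z ℤ.+ ℤ.- + ((k + h) * suc k) ℤ.* + 1) ℤ.* + suc L) (sym (ℤ.pos-* h (suc L))))
           (e (+ (h * suc L)) (+ ((k + h) * suc k)) (+ suc L)))) ⟩
  mkℚᵘ (+ (h * suc L) ℤ.- + ((k + h) * suc k)) L ∎
  where
  open ℚᵘ.≤-Reasoning
  n = k + (k + h)
  n-2k≡h : + n ℤ.- + (2 * k) ≡ + h
  n-2k≡h = trans (cong₂ ℤ._-_ (trans (ℤ.pos-+ k (k + h)) (cong (ℤ._+_ (+ k)) (ℤ.pos-+ k h))) (ℤ.pos-* 2 k)) (f (+ k) (+ h))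
    where
    f : ∀ k h → k ℤ.+ (k ℤ.+ h) ℤ.- + 2 ℤ.* k ≡ h
    f = ℤ.solve-∀
  n-k≡k+h : + n ℤ.- + k ≡ + (k + h)
  n-k≡k+h = trans (cong (ℤ._- + k) (ℤ.pos-+ k (k + h))) (f (+ k) (+ (k + h)))
    where
    f : ∀ k z → k ℤ.+ z ℤ.- k ≡ z
    f = ℤ.solve-∀
  e : ∀ a b s → (a ℤ.+ ℤ.- b ℤ.* + 1) ℤ.* s ≡ (a ℤ.- b) ℤ.* (+ 1 ℤ.* s)
  e = ℤ.solve-∀

module Exponent (k h L : ℕ) where

  private
    n = k + (k + h)
    e = rate k n L
    P = h * suc L
    R = (k + h) * suc k

    split : ∀ z → (+ posPart z ℤ.- + negPart z) ℤ.* + suc L ≡ z ℤ.* + suc L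
    split z = cong (ℤ._* + suc L) (sym (posPart-negPart z))

  module _ (q : PrimePower) (m : ℕ) (root≤ : order q ^ P ≤ m ^ suc L * order q ^ R) where

    private instance
      q-nonZero : NonZero (order q)
      q-nonZero = order≢0 q

    q^e≤m : q ^ℤ (↥ e) ℚ.≤ ((+ m) / 1) ^ℚ (↧ₙ e)
    q^e≤m = subst (q ^ℤ (↥ e) ℚ.≤_) (/1-homo-^ m (↧ₙ e)) (^ℤ-≤ q (↥ e) (m ^ ↧ₙ e)
      (power-≤ (order q) m L P R root≤ (↧ₙ e) (posPart (↥ e)) (negPart (↥ e))
        (clear-≡ (posPart (↥ e)) (negPart (↥ e)) (suc L) P R (↧ₙ e)
          (trans (split (↥ e)) (cross (rate-≃ k h L))))))
      where
      cross : ∀ {e E} → toℚᵘ e ℚᵘ.≃ mkℚᵘ E L → ↥ e ℤ.* + suc L ≡ E ℤ.* ↧ e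
      cross {e@record{}} (*≡* eq) = eq

    q^r<m : ∀ r → 1 < order q → r ℚ.< e → q ^ℤ (↥ r) ℚ.< ((+ m) / 1) ^ℚ (↧ₙ r)
    q^r<m r 1<q r<e = subst (q ^ℤ (↥ r) ℚ.<_) (/1-homo-^ m (↧ₙ r)) (^ℤ-< q (↥ r) (m ^ ↧ₙ r)
      (power-< (order q) m L P R root≤ (↧ₙ r) (posPart (↥ r)) (negPart (↥ r)) 1<q
        (clear-< (posPart (↥ r)) (negPart (↥ r)) (suc L) P R (↧ₙ r)
          (subst (ℤ._< (+ P ℤ.- + R) ℤ.* ↧ r) (sym (split (↥ r)))
            (cross {r} (ℚᵘ.<-respʳ-≃ (rate-≃ k h L) (ℚ.toℚᵘ-mono-< r<e)))))))
      where
      cross : ∀ {r E} → toℚᵘ r ℚᵘ.< mkℚᵘ E L → ↥ r ℤ.* + suc L ℤ.< E ℤ.* ↧ r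
      cross {r@record{}} (*<* lt) = lt

    -- A negative s is below m at once. Otherwise m ≤ s would give m ^ b ≤ s ^ b < q ^ a ≤ m ^ b,
    -- where a / b is the exponent.
    below : (1ℚ · q ^ᶜ e) ≤ᶜ ⌜ (+ m) / 1 ⌝
    below {t} (s , s′ , s<q^e , _ , t<s , _) = go s<q^e
      where
      0≤m : 0ℚ ℚ.≤ (+ m) / 1
      0≤m = /-mono-≤ 0 m 1 1 z≤n
      t<s′ : t ℚ.< s
      t<s′ = subst (t ℚ.<_) (ℚ.*-identityˡ s) t<s
      go : s <[ q ^ e ] → t ℚ.< (+ m) / 1
      go (inj₁ s<0)    = ℚ.<-trans t<s′ (ℚ.<-≤-trans s<0 0≤m)
      go (inj₂ s^b<q^a) = ℚ.<-trans t<s′ (ℚ.≰⇒> λ m≤s →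
        ℚ.<-irrefl refl (ℚ.<-≤-trans s^b<q^a (ℚ.≤-trans q^e≤m (^ℚ-mono-≤ (↧ₙ e) 0≤m m≤s))))

-- For small q the factor 1 + δ vanishes, so the empty family will do.
correction : ∀ {ℓ} {P : Set ℓ} → Dec P → ℚ
correction (yes _) = ℚ.- 1ℚ
correction (no  _) = 0ℚ

correction-vanishing : ∀ N → Vanishing λ q → correction (q <? N)
correction-vanishing N ε 0<ε = N , λ q N≤q → vanish q N≤q (q <? N)
  where
  vanish : ∀ q → N ≤ q → (d : Dec (q < N)) → ℚ.∣ correction d ∣ ℚ.< ε
  vanish q N≤q (yes q<N) = contradiction N≤q (<⇒≱ q<N)
  vanish q N≤q (no _)    = 0<ε

-- The lower bound for every q and the bound on the limsup

module _ (k h L : ℕ) (0<L : 0 < L) where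

  private
    n = suc k + (suc k + h)
    N = threshold n L
    e = rate (suc k) n L

    Large : ℕ → ℕ → Set
    Large q m = q ^ (h * suc L) ≤ m ^ suc L * q ^ ((suc k + h) * suc (suc k))

    family : ∀ {q} (K : FiniteField q) → N ≤ q → ∃[ m ] HasASFamily K n (suc k) L m × Large q m
    family {q} K N≤q =
      let m , F , large = large-family K k h L 0<L N≤q
      in m , F , subst (_≤ m ^ suc L * q ^ ((suc k + h) * suc (suc k))) (^-*-assoc q h (suc L)) large

  lower-bound : ∀ (q : PrimePower) (K : FiniteField (order q)) (d : Dec (order q < N)) →
    ∃[ m ] HasASFamily K n (suc k) L m × ((1ℚ ℚ.+ correction d) · q ^ᶜ e) ≤ᶜ ⌜ (+ m) / 1 ⌝
  lower-bound q K (yes _)   = 0 ,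
    Coordinates.almostSparse⇒family K [] ((λ ()) , (λ ()) , λ _ _ → z≤n) ,
    -- The factor 1 + δ evaluates to 0 here, so membership in the cut says t < 0 · s = 0.
    λ {t} (s , _ , _ , _ , t<0*s , _) → subst (t ℚ.<_) (ℚ.*-zeroˡ s) t<0*s
  lower-bound q K (no q≮N) =
    let m , F , large = family K (≮⇒≥ q≮N)
    in m , F , λ {t} → Exponent.below (suc k) h L q m large {t}

  limsup-bound : ⌜ e ⌝ ≤ᶜ pAS n (suc k) L
  limsup-bound t<e =
    -- The cut of a limsup asks for a rational strictly above t; density provides one still below
    -- the exponent.
    let r , t<r , r<e = ℚ.<-dense t<e
    in r , t<r , λ N′ →
      -- The prime lies beyond N′ for the limsup and beyond N for the family. The order of `q` is p
      -- ^ 1, which does not compute to p, hence the transports.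
      let p , N<p , isPrime = ∃-prime (N′ + N)
          q = record { base = p ; exponent = 1 ; isPrime = isPrime ; exponent≢0 = _ }
          p≡p^1 = sym (^-identityʳ p)
          K = subst FiniteField p≡p^1 (PrimeField.finiteField isPrime)
          1<q = subst (1 <_) p≡p^1 (PrimeField.1<p isPrime)
          above = λ {M} (M≤ : M ≤ N′ + N) → subst (M ≤_) p≡p^1 (≤-trans M≤ (<⇒≤ N<p))
          m₀ , F , large₀ = family K (above (m≤n+m N N′))
          -- The logarithm is that of the maximum, which inherits the lower bound from the family
          -- just found.
          m , max , m₀≤m = Coordinates.∃-maximum K F
          large = ≤-trans large₀ (*-monoˡ-≤ (order q ^ ((suc k + h) * suc (suc k))) (^-monoˡ-≤ (suc L) m₀≤m))
      in q , above (m≤m+n N′ N) , K , m , max ,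
         /-mono-< 0 m 1 1 (subst (0 <_) (sym (*-identityʳ m)) (positive q m large)) ,
         Exponent.q^r<m (suc k) h L q m large r 1<q r<e
    where
    positive : ∀ q m → Large (order q) m → 0 < m
    positive q zero    le = contradiction le (<⇒≱ (m^n>0 (order q) {{order≢0 q}} (h * suc L)))
    positive q (suc m) le = s≤s z≤n

theorem2 : ∀ (k n L : ℕ) → 0 < k → 0 < n → 0 < L → 2 * k < n →
    let e = ((+ n ℤ.- + (2 * k)) / 1) ℚ.- (((+ n ℤ.- + k) ℤ.* + suc k) / suc L) in
    (Σ[ δ ∈ (ℕ → ℚ) ] Vanishing δ ×
    (∀ (q : PrimePower) (K : FiniteField (order q)) →
    ∃[ m ] HasASFamily K n k L m ×
    ((1ℚ ℚ.+ δ (order q)) · q ^ᶜ e) ≤ᶜ ⌜ (+ m) / 1 ⌝))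
    × (⌜ e ⌝ ≤ᶜ pAS n k L)
-- With h = n - 2k, n is brought to the form k + (k + h) of the graph construction: k rows and k + h
-- columns.
theorem2 (suc k) n L _ _ 0<L 2k<n with m≤n⇒∃[o]m+o≡n (<⇒≤ 2k<n)
... | h , 2k+h≡n with trans (sym 2k+h≡n) (rearrange (suc k) h)
  where
  rearrange : ∀ k h → 2 * k + h ≡ k + (k + h)
  rearrange = solve-∀
... | refl = ((λ q → correction (q <? N)) , correction-vanishing N , λ q K → lower-bound k h L 0<L q K (order q <? N)) ,
  λ {t} → limsup-bound k h L 0<L {t}
  where N = threshold (suc k + (suc k + h)) L
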